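{- Let $G$ be a topological group, let $\mathfrak M$ be a $G$-Mackey system consisting of closed subgroups of $G$ such that $[H:I]<\infty$ whenever $H\in\mathfrak M_{\mathrm b}$ and $I\in\mathfrak M_{\mathrm r}(H)$ (i.e. $\mathfrak M\le\mathrm{Grp}(G)^{\mathrm{r\text{ - }f}}$), and let $\mathrm R$ be an abelianization system on $\mathfrak M$. Then $\pi_{\mathrm R}:\mathfrak M\to\mathsf{TAb}$ is a cohomological Mackey functor.
   Context: $\mathsf{TAb}$ is the category of topological abelian groups. ${}^gH=gHg^{ -1}$, $H^g=g^{ -1}Hg$. A $G$-Mackey system $\mathfrak M=(\mathfrak M_{\mathrm b},\mathfrak M_{\mathrm r},\mathfrak M_{\mathrm i})$ consists of a non-empty set $\mathfrak M_{\mathrm b}$ of subgroups of $G$ closed under conjugation and, for each $H\in\mathfrak M_{\mathrm b}$ and $\star\in\{\mathrm r,\mathrm i\}$, a set $\mathfrak M_\star(H)\subseteq\{I\in\mathfrak M_{\mathrm b}:I\le H\}$ with $H\in\mathfrak M_\star(H)$; $I\in\mathfrak M_\star(H)\Rightarrow\mathfrak M_\star(I)\subseteq\mathfrak M_\star(H)$; ${}^g\mathfrak M_\star(H)=\mathfrak M_\star({}^gH)$; and for $I\in\mathfrak M_{\mathrm r}(H)$, $J\in\mathfrak M_{\mathrm i}(H)$: $I\backslash H/J$ is finite, $I\cap J\in\mathfrak M_{\mathrm r}(J)$, $I\cap J\in\mathfrak M_{\mathrm i}(I)$. A Mackey functor $\Phi:\mathfrak M\to\mathsf{TAb}$ consists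 of objects $\Phi(H)$ ($H\in\mathfrak M_{\mathrm b}$) and morphisms $\mathrm{res}_{I,H}:\Phi(H)\to\Phi(I)$ ($I\in\mathfrak M_{\mathrm r}(H)$), $\mathrm{ind}_{H,I}:\Phi(I)\to\Phi(H)$ ($I\in\mathfrak M_{\mathrm i}(H)$), $\mathrm{con}_{g,H}:\Phi(H)\to\Phi({}^gH)$ with: $\mathrm{res}_{H,H}=\mathrm{ind}_{H,H}=\mathrm{id}$, $\mathrm{con}_{h,H}=\mathrm{id}$ for $h\in H$; $\mathrm{res}_{J,I}\mathrm{res}_{I,H}=\mathrm{res}_{J,H}$, $\mathrm{ind}_{H,I}\mathrm{ind}_{I,J}=\mathrm{ind}_{H,J}$, $\mathrm{con}_{g',{}^gH}\mathrm{con}_{g,H}=\mathrm{con}_{g'g,H}$; $\mathrm{con}_{g,I}\mathrm{res}_{I,H}=\mathrm{res}_{{}^gI,{}^gH}\mathrm{con}_{g,H}$, $\mathrm{con}_{g,H}\mathrm{ind}_{H,I}=\mathrm{ind}_{{}^gH,{}^gI}\mathrm{con}_{g,I}$; and the Mackey formula $\mathrm{res}_{I,H}\mathrm{ind}_{H,J}=\sum_{h}\mathrm{ind}_{I,I\cap{}^hJ}\,\mathrm{con}_{h,I^h\cap J}\,\mathrm{res}_{I^h\cap J,J}$ ($h$ over representatives of $I\backslash H/J$). It is cohomological if $\mathrm{ind}_{H,I}\mathrm{res}_{I,H}=[H:I]\cdot\mathrm{id}$ for $I\in\mathfrak M_{\mathrm r}(H)\cap\mathfrak M_{\mathrm i}(H)$.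 Transfer. For $I\le H$ closed of finite index with right transversal $T=(t_1,\dots,t_n)$ write $t_ih=\kappa_T(t_ih)t_{\sigma(i)}$ with $\kappa_T(t_ih)\in I$ and $\sigma$ a permutation. For $N\lhd I$ with $I/N$ abelian, $\mathrm V^N_{I,H}:H\to I/N$, $h\mapsto\prod_i\kappa_T(t_ih)\bmod N$, is a continuous homomorphism independent of $T$. An abelianization system on $\mathfrak M$ is a family $\mathrm R=\{\mathrm R(H):H\in\mathfrak M_{\mathrm b}\}$ of closed normal subgroups $\mathrm R(H)\lhd H$ with $H/\mathrm R(H)$ abelian, $\mathrm R({}^gH)={}^g\mathrm R(H)$, $\mathrm R(H)\subseteq\ker\mathrm V^{\mathrm R(I)}_{I,H}$ for $I\in\mathfrak M_{\mathrm r}(H)$, and $\mathrm R(I)\subseteq\mathrm R(H)$ for $I\in\mathfrak M_{\mathrm i}(H)$. Then $\pi_{\mathrm R}(H)=H/\mathrm R(H)$, with $\mathrm{con}_{g,H}$ induced by $h\mapsto ghg^{ -1}$, $\mathrm{res}_{I,H}:H/\mathrm R(H)\to I/\mathrm R(I)$ induced by $\mathrm V^{\mathrm R(I)}_{I,H}$, and $\mathrm{ind}_{H,I}:I/\mathrm R(I)\to H/\mathrm R(H)$ induced by the inclusion. -}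

module Defs where

open import Algebra.Bundles using (Group)
open import Algebra.Bundles.Raw using (RawGroup)
open import Algebra.Definitions using (Commutative)
open import Algebra.Structures using (IsGroup)
open import Algebra.Morphism.Structures using (module GroupMorphisms)
import Algebra.Definitions.RawMonoid as RawMonoidDefinitions
import Algebra.Properties.Group as GroupProperties
open import Data.Fin.Base using (Fin)
open import Data.Nat.Base using (ℕ)
open import Data.Product.Base using (Σ; ∃; _×_; _,_; proj₁; proj₂; Σ-syntax; ∃-syntax; uncurry)
open import Data.Unit.Polymorphic.Base using (⊤)
open import Level using (Level; suc; _⊔_)
open import Relation.Binary.Core using (Rel)
open import Relation.Binary.Definitions using (_Respects_)
open import Relation.Binary.PropositionalEquality.Core using (_≡_)
import Relation.Binary.Reasoning.Setoid as SetoidReasoning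
open import Relation.Unary using (Pred; _∈_; _⊆_; _≐_; _∩_; ∁; ⋃; _⊢_)

private
  variable
    v ℓ m : Level

-- A space is a setoid, so an open set has to respect its equality.  Families
-- of open sets are indexed by small types: every family of subsets of X can
-- be so indexed up to _≐_, classically.
record IsTopology {X : Set ℓ} (_≈_ : Rel X ℓ)
                  (Open : Pred (Pred X ℓ) (suc ℓ)) : Set (suc ℓ) where
  field
    Open-resp-≐ : ∀ {U V} → U ≐ V → Open U → Open V
    respects    : ∀ {U} → Open U → U Respects _≈_
    Open-⊤      : Open (λ _ → ⊤)
    Open-∩      : ∀ {U V} → Open U → Open V → Open (U ∩ V)
    Open-⋃      : ∀ {A : Set ℓ} {U : A → Pred X ℓ} →
                  (∀ a → Open (U a)) → Open (⋃ A U)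

Continuous : {X Y : Set ℓ} → Pred (Pred X ℓ) (suc ℓ) → Pred (Pred Y ℓ) (suc ℓ) →
             (X → Y) → Set (suc ℓ)
Continuous OpenX OpenY f = ∀ {V} → OpenY V → OpenX (f ⊢ V)

ProductOpen : {X Y : Set ℓ} → Pred (Pred X ℓ) (suc ℓ) → Pred (Pred Y ℓ) (suc ℓ) →
              Pred (Pred (X × Y) ℓ) (suc ℓ)
ProductOpen OpenX OpenY W =
  ∀ {x y} → (x , y) ∈ W →
  ∃[ U ] ∃[ V ] OpenX U × OpenY V × x ∈ U × y ∈ V ×
                (∀ {x′ y′} → x′ ∈ U → y′ ∈ V → (x′ , y′) ∈ W)

SubspaceOpen : {X : Set ℓ} → Pred (Pred X ℓ) (suc ℓ) → (H : Pred X ℓ) →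
               Pred (Pred (∃ H) ℓ) (suc ℓ)
SubspaceOpen Open H V = ∃[ U ] Open U × V ≐ (proj₁ ⊢ U)

record RawTopologicalGroup ℓ : Set (suc (suc ℓ)) where
  field
    rawGroup : RawGroup ℓ ℓ
  open RawGroup rawGroup public
  field
    Open : Pred (Pred Carrier ℓ) (suc ℓ)

  open RawMonoidDefinitions rawMonoid public
    using (sum) renaming (_×_ to _·_)

record IsTopologicalGroup (A : RawTopologicalGroup ℓ) : Set (suc ℓ) where
  open RawTopologicalGroup A
  field
    isGroup       : IsGroup _≈_ _∙_ ε _⁻¹
    isTopology    : IsTopology _≈_ Open
    ∙-continuous  : Continuous (ProductOpen Open Open) Open (uncurry _∙_)
    ⁻¹-continuous : Continuous Open Open _⁻¹

record IsTopologicalAbelianGroup (A : RawTopologicalGroup ℓ) : Set (suc ℓ) where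
  open RawTopologicalGroup A
  field
    isTopologicalGroup : IsTopologicalGroup A
    comm               : Commutative _≈_ _∙_

record IsContinuousHomomorphism
         (A B : RawTopologicalGroup ℓ)
         (f : RawTopologicalGroup.Carrier A → RawTopologicalGroup.Carrier B) :
         Set (suc ℓ) where
  private
    module A = RawTopologicalGroup A
    module B = RawTopologicalGroup B
  field
    isGroupHomomorphism : GroupMorphisms.IsGroupHomomorphism A.rawGroup B.rawGroup f
    continuous          : Continuous A.Open B.Open f

record TopologicalGroup ℓ : Set (suc (suc ℓ)) where
  field
    rawTopologicalGroup : RawTopologicalGroup ℓ
    isTopologicalGroup  : IsTopologicalGroup rawTopologicalGroup
  open RawTopologicalGroup rawTopologicalGroup public using (Open)
  open IsTopologicalGroup isTopologicalGroup public
    using (isTopology; ∙-continuous; ⁻¹-continuous)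

  group : Group ℓ ℓ
  group = record { isGroup = IsTopologicalGroup.isGroup isTopologicalGroup }

module _ (G : TopologicalGroup ℓ) where

  open TopologicalGroup G using (Open; group)
  open Group group
  open GroupProperties group
  open SetoidReasoning setoid

  record Subgroup : Set (suc ℓ) where
    field
      ⟨_⟩       : Pred Carrier ℓ
      resp-≈    : ⟨_⟩ Respects _≈_
      ε-closed  : ε ∈ ⟨_⟩
      ∙-closed  : ∀ {x y} → x ∈ ⟨_⟩ → y ∈ ⟨_⟩ → x ∙ y ∈ ⟨_⟩
      ⁻¹-closed : ∀ {x} → x ∈ ⟨_⟩ → x ⁻¹ ∈ ⟨_⟩

  open Subgroup public using (⟨_⟩)
  open Subgroup

  infix 4 _≤_ _≋_

  _≤_ : Rel Subgroup ℓ
  H ≤ K = ⟨ H ⟩ ⊆ ⟨ K ⟩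

  _≋_ : Rel Subgroup ℓ
  H ≋ K = ⟨ H ⟩ ≐ ⟨ K ⟩

  IsClosed : Pred Subgroup (suc ℓ)
  IsClosed H = Open (∁ ⟨ H ⟩)

  infixr 7 _⊓_

  _⊓_ : Subgroup → Subgroup → Subgroup
  H ⊓ K = record
    { ⟨_⟩       = ⟨ H ⟩ ∩ ⟨ K ⟩
    ; resp-≈    = λ x≈y (p , q) → resp-≈ H x≈y p , resp-≈ K x≈y q
    ; ε-closed  = ε-closed H , ε-closed K
    ; ∙-closed  = λ (p , q) (p′ , q′) → ∙-closed H p p′ , ∙-closed K q q′
    ; ⁻¹-closed = λ (p , q) → ⁻¹-closed H p , ⁻¹-closed K q
    }

  conjBy : Carrier → Carrier → Carrier
  conjBy g x = g ∙ x ∙ g ⁻¹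

  conjBy-cong : ∀ {g h x y} → g ≈ h → x ≈ y → conjBy g x ≈ conjBy h y
  conjBy-cong p q = ∙-cong (∙-cong p q) (⁻¹-cong p)

  conjBy-∙ : ∀ g x y → conjBy g x ∙ conjBy g y ≈ conjBy g (x ∙ y)
  conjBy-∙ g x y = begin
    (g ∙ x ∙ g ⁻¹) ∙ (g ∙ y ∙ g ⁻¹)   ≈⟨ assoc _ _ _ ⟨
    g ∙ x ∙ g ⁻¹ ∙ (g ∙ y) ∙ g ⁻¹     ≈⟨ ∙-congʳ (assoc _ _ _) ⟩
    g ∙ x ∙ (g ⁻¹ ∙ (g ∙ y)) ∙ g ⁻¹   ≈⟨ ∙-congʳ (∙-congˡ (\\-leftDividesʳ g y)) ⟩
    g ∙ x ∙ y ∙ g ⁻¹                  ≈⟨ ∙-congʳ (assoc _ _ _) ⟩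
    g ∙ (x ∙ y) ∙ g ⁻¹                ∎

  conjBy-ε : ∀ g → conjBy g ε ≈ ε
  conjBy-ε g = trans (∙-congʳ (identityʳ g)) (inverseʳ g)

  conjBy-⁻¹ : ∀ g x → conjBy g x ⁻¹ ≈ conjBy g (x ⁻¹)
  conjBy-⁻¹ g x = sym (inverseˡ-unique _ _ (begin
    conjBy g (x ⁻¹) ∙ conjBy g x  ≈⟨ conjBy-∙ g _ _ ⟩
    conjBy g (x ⁻¹ ∙ x)           ≈⟨ conjBy-cong refl (inverseˡ x) ⟩
    conjBy g ε                    ≈⟨ conjBy-ε g ⟩
    ε                             ∎))

  conjBy-action : ∀ g h x → conjBy g (conjBy h x) ≈ conjBy (g ∙ h) x
  conjBy-action g h x = begin
    g ∙ (h ∙ x ∙ h ⁻¹) ∙ g ⁻¹    ≈⟨ ∙-congʳ (assoc _ _ _) ⟨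
    g ∙ (h ∙ x) ∙ h ⁻¹ ∙ g ⁻¹    ≈⟨ assoc _ _ _ ⟩
    g ∙ (h ∙ x) ∙ (h ⁻¹ ∙ g ⁻¹)  ≈⟨ ∙-cong (assoc g h x) (⁻¹-anti-homo-∙ g h) ⟨
    g ∙ h ∙ x ∙ (g ∙ h) ⁻¹       ∎

  conjBy-identity : ∀ x → conjBy ε x ≈ x
  conjBy-identity x = trans (∙-cong (identityˡ x) ε⁻¹≈ε) (identityʳ x)

  conjBy-inverse : ∀ g x → conjBy (g ⁻¹) (conjBy g x) ≈ x
  conjBy-inverse g x = begin
    conjBy (g ⁻¹) (conjBy g x)  ≈⟨ conjBy-action _ _ _ ⟩
    conjBy (g ⁻¹ ∙ g) x         ≈⟨ conjBy-cong (inverseˡ g) refl ⟩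
    conjBy ε x                  ≈⟨ conjBy-identity x ⟩
    x                           ∎

  conjBy-closed : ∀ (H : Subgroup) {g x} → g ∈ ⟨ H ⟩ → x ∈ ⟨ H ⟩ → conjBy g x ∈ ⟨ H ⟩
  conjBy-closed H p q = ∙-closed H (∙-closed H p q) (⁻¹-closed H p)

  -- ᵍH = gHg⁻¹, as the set of all x with g⁻¹xg ∈ H.
  conj : Carrier → Subgroup → Subgroup
  conj g H = record
    { ⟨_⟩       = λ x → conjBy (g ⁻¹) x ∈ ⟨ H ⟩
    ; resp-≈    = λ x≈y → resp-≈ H (conjBy-cong refl x≈y)
    ; ε-closed  = resp-≈ H (sym (conjBy-ε _)) (ε-closed H)
    ; ∙-closed  = λ p q → resp-≈ H (conjBy-∙ _ _ _) (∙-closed H p q)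
    ; ⁻¹-closed = λ p → resp-≈ H (conjBy-⁻¹ _ _) (⁻¹-closed H p)
    }

  conj-cong : ∀ {g h H K} → g ≈ h → H ≋ K → conj g H ≋ conj h K
  conj-cong {H = H} {K} g≈h (H⊆K , K⊆H) =
    (λ p → H⊆K (resp-≈ H (conjBy-cong (⁻¹-cong g≈h) refl) p)) ,
    (λ p → K⊆H (resp-≈ K (conjBy-cong (⁻¹-cong (sym g≈h)) refl) p))

  conj-∙ : ∀ g′ g H → conj g′ (conj g H) ≋ conj (g′ ∙ g) H
  conj-∙ g′ g H = resp-≈ H eq , resp-≈ H (sym eq)
    where
    eq : ∀ {x} → conjBy (g ⁻¹) (conjBy (g′ ⁻¹) x) ≈ conjBy ((g′ ∙ g) ⁻¹) x
    eq = trans (conjBy-action _ _ _)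
               (conjBy-cong (sym (⁻¹-anti-homo-∙ g′ g)) refl)

  conj-self : ∀ {h} H → h ∈ ⟨ H ⟩ → conj h H ≋ H
  conj-self {h} H h∈H =
    (λ {x} p → resp-≈ H
      (trans (conjBy-cong (sym (⁻¹-involutive h)) refl) (conjBy-inverse (h ⁻¹) x))
      (conjBy-closed H h∈H p)) ,
    conjBy-closed H (⁻¹-closed H h∈H)

  -- ʰ(Iʰ ∩ J) = I ∩ ʰJ, where Iʰ = h⁻¹Ih.
  conj-⊓ : ∀ h I J → conj h (conj (h ⁻¹) I ⊓ J) ≋ I ⊓ conj h J
  conj-⊓ h I J =
    (λ (p , q) → resp-≈ I (conjBy-inverse _ _) p , q) ,
    (λ (p , q) → resp-≈ I (sym (conjBy-inverse _ _)) p , q)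

  -- H is the disjoint union of the cosets I · rep i, so [H:I] = n.
  record RightTransversal (H I : Subgroup) (n : ℕ) : Set ℓ where
    field
      rep      : Fin n → Carrier
      rep∈     : ∀ i → rep i ∈ ⟨ H ⟩
      cover    : ∀ {x} → x ∈ ⟨ H ⟩ → ∃[ i ] x ∙ rep i ⁻¹ ∈ ⟨ I ⟩
      distinct : ∀ {i j} → rep i ∙ rep j ⁻¹ ∈ ⟨ I ⟩ → i ≡ j

  FiniteIndex : Subgroup → Subgroup → Set ℓ
  FiniteIndex H I = ∃[ n ] RightTransversal H I n

  InDoubleCoset : (I J : Subgroup) → Rel Carrier ℓ
  InDoubleCoset I J h x =
    ∃[ a ] ∃[ b ] a ∈ ⟨ I ⟩ × b ∈ ⟨ J ⟩ × x ≈ a ∙ h ∙ b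

  -- H is the disjoint union of the double cosets I · rep k · J.
  record DoubleCosetRepresentatives (I H J : Subgroup) (n : ℕ) : Set ℓ where
    field
      rep      : Fin n → Carrier
      rep∈     : ∀ k → rep k ∈ ⟨ H ⟩
      cover    : ∀ {x} → x ∈ ⟨ H ⟩ → ∃[ k ] InDoubleCoset I J (rep k) x
      distinct : ∀ {k l} → InDoubleCoset I J (rep k) (rep l) → k ≡ l

  -- H/N with the quotient of the subspace topology: N only enters through the
  -- equality, and the open sets are the open sets of H that respect it.  This
  -- is meant for N a normal subgroup of H.
  infix 6 _/_

  _/_ : Subgroup → Subgroup → RawTopologicalGroup ℓ
  H / N = record
    { rawGroup = record
      { Carrier = ∃ ⟨ H ⟩
      ; _≈_     = _∼_
      ; _∙_     = λ (x , p) (y , q) → x ∙ y , ∙-closed H p q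
      ; ε       = ε , ε-closed H
      ; _⁻¹     = λ (x , p) → x ⁻¹ , ⁻¹-closed H p
      }
    ; Open = λ V → SubspaceOpen Open ⟨ H ⟩ V × V Respects _∼_
    }
    where
    _∼_ : Rel (∃ ⟨ H ⟩) ℓ
    (x , _) ∼ (y , _) = x ⁻¹ ∙ y ∈ ⟨ N ⟩

  module _ {H I N : Subgroup} {n} (T : RightTransversal H I n) where
    open RightTransversal T

    -- κ_T(tᵢh) = tᵢh · t_{σ(i)}⁻¹, where tᵢh ∈ I · t_{σ(i)}.
    κ : ∃ ⟨ H ⟩ → Fin n → ∃ ⟨ I ⟩
    κ (h , h∈H) i =
      let σi , p = cover (∙-closed H (rep∈ i) h∈H)
      in  rep i ∙ h ∙ rep σi ⁻¹ , p

    transfer : ∃ ⟨ H ⟩ → RawTopologicalGroup.Carrier (I / N)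
    transfer h = RawTopologicalGroup.sum (I / N) (κ h)

  data Mode : Set where
    r i : Mode

  -- 𝔐⋆ relates members of 𝔐b, i.e. subgroups with a proof of membership; that
  -- it does not depend on these proofs is part of 𝔐⋆-resp-≋.
  record MackeySystem m : Set (suc ℓ ⊔ suc m) where
    field
      𝔐b          : Pred Subgroup m
      𝔐b-resp-≋   : 𝔐b Respects _≋_
      𝔐b-nonempty : ∃ 𝔐b
      𝔐b-conj     : ∀ g {H} → 𝔐b H → 𝔐b (conj g H)

    Member : Set (suc ℓ ⊔ m)
    Member = ∃ 𝔐b

    ⌊_⌋ : Member → Subgroup
    ⌊_⌋ = proj₁

    conjᴹ : Carrier → Member → Member
    conjᴹ g (H , b) = conj g H , 𝔐b-conj g b

    field
      𝔐⋆        : Mode → Member → Pred Member m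
      𝔐⋆-resp-≋ : ∀ {⋆ I I′ H H′} → ⌊ I ⌋ ≋ ⌊ I′ ⌋ → ⌊ H ⌋ ≋ ⌊ H′ ⌋ →
                  I ∈ 𝔐⋆ ⋆ H → I′ ∈ 𝔐⋆ ⋆ H′
      𝔐⋆-≤      : ∀ {⋆ I H} → I ∈ 𝔐⋆ ⋆ H → ⌊ I ⌋ ≤ ⌊ H ⌋
      𝔐⋆-refl   : ∀ {⋆} H → H ∈ 𝔐⋆ ⋆ H
      𝔐⋆-trans  : ∀ {⋆ J I H} → J ∈ 𝔐⋆ ⋆ I → I ∈ 𝔐⋆ ⋆ H → J ∈ 𝔐⋆ ⋆ H
      -- ᵍ𝔐⋆(H) ⊆ 𝔐⋆(ᵍH) for all g; the reverse inclusion is the case of g⁻¹.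
      𝔐⋆-conj   : ∀ {⋆} g {I H} → I ∈ 𝔐⋆ ⋆ H → conjᴹ g I ∈ 𝔐⋆ ⋆ (conjᴹ g H)

    infix 4 _∈𝔐ᵣ_ _∈𝔐ᵢ_

    _∈𝔐ᵣ_ : Rel Member m
    I ∈𝔐ᵣ H = I ∈ 𝔐⋆ r H

    _∈𝔐ᵢ_ : Rel Member m
    I ∈𝔐ᵢ H = I ∈ 𝔐⋆ i H

    field
      finite : ∀ {I J H} → I ∈𝔐ᵣ H → J ∈𝔐ᵢ H →
               ∃ (DoubleCosetRepresentatives ⌊ I ⌋ ⌊ H ⌋ ⌊ J ⌋)
      𝔐b-⊓   : ∀ {I J H} → I ∈𝔐ᵣ H → J ∈𝔐ᵢ H → 𝔐b (⌊ I ⌋ ⊓ ⌊ J ⌋)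
      𝔐ᵣ-⊓   : ∀ {I J H} (p : I ∈𝔐ᵣ H) (q : J ∈𝔐ᵢ H) →
               (⌊ I ⌋ ⊓ ⌊ J ⌋ , 𝔐b-⊓ p q) ∈𝔐ᵣ J
      𝔐ᵢ-⊓   : ∀ {I J H} (p : I ∈𝔐ᵣ H) (q : J ∈𝔐ᵢ H) →
               (⌊ I ⌋ ⊓ ⌊ J ⌋ , 𝔐b-⊓ p q) ∈𝔐ᵢ I

  module _ (𝔐 : MackeySystem m) where
    open MackeySystem 𝔐

    conj-∈ : ∀ {⋆ h I} H → h ∈ ⟨ ⌊ H ⌋ ⟩ → I ∈ 𝔐⋆ ⋆ H → conjᴹ h I ∈ 𝔐⋆ ⋆ H
    conj-∈ H h∈H p =
      𝔐⋆-resp-≋ ((λ z → z) , (λ z → z)) (conj-self ⌊ H ⌋ h∈H) (𝔐⋆-conj _ p)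

    module _ {I J H : Member} (p : I ∈𝔐ᵣ H) (q : J ∈𝔐ᵢ H)
             {h : Carrier} (h∈H : h ∈ ⟨ ⌊ H ⌋ ⟩) where
      private
        p′ : conjᴹ (h ⁻¹) I ∈𝔐ᵣ H
        p′ = conj-∈ H (⁻¹-closed ⌊ H ⌋ h∈H) p

        q′ : conjᴹ h J ∈𝔐ᵢ H
        q′ = conj-∈ H h∈H q

      Iʰ∩J : Member
      Iʰ∩J = conj (h ⁻¹) ⌊ I ⌋ ⊓ ⌊ J ⌋ , 𝔐b-⊓ p′ q

      Iʰ∩J∈𝔐ᵣ : Iʰ∩J ∈𝔐ᵣ J
      Iʰ∩J∈𝔐ᵣ = 𝔐ᵣ-⊓ p′ q

      I∩ʰJ : Member
      I∩ʰJ = ⌊ I ⌋ ⊓ conj h ⌊ J ⌋ , 𝔐b-⊓ p q′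

      I∩ʰJ∈𝔐ᵢ : I∩ʰJ ∈𝔐ᵢ I
      I∩ʰJ∈𝔐ᵢ = 𝔐ᵢ-⊓ p q′

    -- Subgroups that are equal as sets, such as ʰH and H for h ∈ H, need not be
    -- definitionally equal, so Φ is a family over the setoid of members: cast
    -- is the identification of Φ(H) with Φ(K) for H = K.
    record RawMackeyFunctor v : Set (suc (suc v) ⊔ suc ℓ ⊔ m) where
      field
        Φ : Member → RawTopologicalGroup v

      ∣Φ_∣ : Member → Set v
      ∣Φ H ∣ = RawTopologicalGroup.Carrier (Φ H)

      field
        cast : ∀ {H K} → ⌊ H ⌋ ≋ ⌊ K ⌋ → ∣Φ H ∣ → ∣Φ K ∣
        res  : ∀ {I H} → I ∈𝔐ᵣ H → ∣Φ H ∣ → ∣Φ I ∣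
        ind  : ∀ {I H} → I ∈𝔐ᵢ H → ∣Φ I ∣ → ∣Φ H ∣
        con  : ∀ g H → ∣Φ H ∣ → ∣Φ conjᴹ g H ∣

    record IsMackeyFunctor (F : RawMackeyFunctor v) : Set (suc v ⊔ suc ℓ ⊔ m) where
      open RawMackeyFunctor F

      infix 4 _≈Φ_
      _≈Φ_ : ∀ {H} → Rel ∣Φ H ∣ v
      _≈Φ_ {H} = RawTopologicalGroup._≈_ (Φ H)

      field
        Φ-TAb    : ∀ H → IsTopologicalAbelianGroup (Φ H)
        cast-TAb : ∀ {H K} (e : ⌊ H ⌋ ≋ ⌊ K ⌋) →
                   IsContinuousHomomorphism (Φ H) (Φ K) (cast {H} {K} e)
        res-TAb  : ∀ {I H} (p : I ∈𝔐ᵣ H) → IsContinuousHomomorphism (Φ H) (Φ I) (res p)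
        ind-TAb  : ∀ {I H} (p : I ∈𝔐ᵢ H) → IsContinuousHomomorphism (Φ I) (Φ H) (ind p)
        con-TAb  : ∀ g H → IsContinuousHomomorphism (Φ H) (Φ (conjᴹ g H)) (con g H)

        cast-id    : ∀ {H} (e : ⌊ H ⌋ ≋ ⌊ H ⌋) x → _≈Φ_ {H} (cast {H} {H} e x) x
        cast-trans : ∀ {H K L} (e : ⌊ H ⌋ ≋ ⌊ K ⌋) (e′ : ⌊ K ⌋ ≋ ⌊ L ⌋)
                     (e″ : ⌊ H ⌋ ≋ ⌊ L ⌋) x →
                     _≈Φ_ {L} (cast {K} {L} e′ (cast {H} {K} e x)) (cast {H} {L} e″ x)
        res-cast   : ∀ {I I′ H H′} (e : ⌊ I ⌋ ≋ ⌊ I′ ⌋) (e′ : ⌊ H ⌋ ≋ ⌊ H′ ⌋)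
                     (p : I ∈𝔐ᵣ H) (p′ : I′ ∈𝔐ᵣ H′) x →
                     _≈Φ_ {I′} (cast {I} {I′} e (res p x)) (res p′ (cast {H} {H′} e′ x))
        ind-cast   : ∀ {I I′ H H′} (e : ⌊ I ⌋ ≋ ⌊ I′ ⌋) (e′ : ⌊ H ⌋ ≋ ⌊ H′ ⌋)
                     (p : I ∈𝔐ᵢ H) (p′ : I′ ∈𝔐ᵢ H′) x →
                     _≈Φ_ {H′} (cast {H} {H′} e′ (ind p x)) (ind p′ (cast {I} {I′} e x))
        con-cast   : ∀ {g g′ H H′} (g≈g′ : g ≈ g′) (e : ⌊ H ⌋ ≋ ⌊ H′ ⌋) x →
                     _≈Φ_ {conjᴹ g′ H′}
                       (cast {conjᴹ g H} {conjᴹ g′ H′}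
                             (conj-cong {H = ⌊ H ⌋} {⌊ H′ ⌋} g≈g′ e) (con g H x))
                       (con g′ H′ (cast {H} {H′} e x))

        res-id : ∀ {H} (p : H ∈𝔐ᵣ H) x → _≈Φ_ {H} (res p x) x
        ind-id : ∀ {H} (p : H ∈𝔐ᵢ H) x → _≈Φ_ {H} (ind p x) x
        con-id : ∀ {h} H (h∈H : h ∈ ⟨ ⌊ H ⌋ ⟩) x →
                 _≈Φ_ {H} (cast {conjᴹ h H} {H} (conj-self ⌊ H ⌋ h∈H) (con h H x)) x

        res-trans : ∀ {J I H} (p : J ∈𝔐ᵣ I) (q : I ∈𝔐ᵣ H) x →
                    _≈Φ_ {J} (res p (res q x)) (res (𝔐⋆-trans p q) x)
        ind-trans : ∀ {J I H} (p : J ∈𝔐ᵢ I) (q : I ∈𝔐ᵢ H) x →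
                    _≈Φ_ {H} (ind q (ind p x)) (ind (𝔐⋆-trans p q) x)
        con-trans : ∀ g′ g H x →
                    _≈Φ_ {conjᴹ (g′ ∙ g) H}
                      (cast {conjᴹ g′ (conjᴹ g H)} {conjᴹ (g′ ∙ g) H}
                            (conj-∙ g′ g ⌊ H ⌋) (con g′ (conjᴹ g H) (con g H x)))
                      (con (g′ ∙ g) H x)

        con-res : ∀ g {I H} (p : I ∈𝔐ᵣ H) x →
                  _≈Φ_ {conjᴹ g I} (con g I (res p x)) (res (𝔐⋆-conj g p) (con g H x))
        con-ind : ∀ g {I H} (p : I ∈𝔐ᵢ H) x →
                  _≈Φ_ {conjᴹ g H} (con g H (ind p x)) (ind (𝔐⋆-conj g p) (con g I x))

        mackey : ∀ {I J H} (p : I ∈𝔐ᵣ H) (q : J ∈𝔐ᵢ H) {n}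
                 (D : DoubleCosetRepresentatives ⌊ I ⌋ ⌊ H ⌋ ⌊ J ⌋ n)
                 (let open DoubleCosetRepresentatives D) x →
                 _≈Φ_ {I}
                   (res p (ind q x))
                   (RawTopologicalGroup.sum (Φ I) λ k →
                     let Iʰ∩Jₖ = Iʰ∩J p q (rep∈ k)
                         I∩ʰJₖ = I∩ʰJ p q (rep∈ k)
                     in  ind (I∩ʰJ∈𝔐ᵢ p q (rep∈ k))
                           (cast {conjᴹ (rep k) Iʰ∩Jₖ} {I∩ʰJₖ}
                                 (conj-⊓ (rep k) ⌊ I ⌋ ⌊ J ⌋)
                             (con (rep k) Iʰ∩Jₖ
                               (res (Iʰ∩J∈𝔐ᵣ p q (rep∈ k)) x))))

    IsCohomological : RawMackeyFunctor v → Set (suc ℓ ⊔ m ⊔ v)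
    IsCohomological F =
      ∀ {I H} (p : I ∈𝔐ᵣ H) (q : I ∈𝔐ᵢ H) {n} → RightTransversal ⌊ H ⌋ ⌊ I ⌋ n →
      ∀ x → let open RawTopologicalGroup (Φ H) renaming (_≈_ to _≈Φ_)
            in  ind q (res p x) ≈Φ n · x
      where open RawMackeyFunctor F

    record IsCohomologicalMackeyFunctor (F : RawMackeyFunctor v) :
             Set (suc v ⊔ suc ℓ ⊔ m) where
      field
        isMackeyFunctor : IsMackeyFunctor F
        isCohomological : IsCohomological F

    record AbelianizationSystem : Set (suc ℓ ⊔ m) where
      field
        R        : Member → Subgroup
        R-resp-≋ : ∀ {H K} → ⌊ H ⌋ ≋ ⌊ K ⌋ → R H ≋ R K
        R≤       : ∀ H → R H ≤ ⌊ H ⌋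
        R-closed : ∀ H → SubspaceOpen Open ⟨ ⌊ H ⌋ ⟩ (proj₁ ⊢ ∁ ⟨ R H ⟩)
        R-normal : ∀ H {h x} → h ∈ ⟨ ⌊ H ⌋ ⟩ → x ∈ ⟨ R H ⟩ → h ∙ x ∙ h ⁻¹ ∈ ⟨ R H ⟩
        R-abelian : ∀ H → let module H/R = RawTopologicalGroup (⌊ H ⌋ / R H)
                          in  Commutative H/R._≈_ H/R._∙_
        R-conj   : ∀ g H → R (conjᴹ g H) ≋ conj g (R H)
        -- The transfer to I/R(I) does not depend on the transversal.
        R-res    : ∀ {I H} → I ∈𝔐ᵣ H → ∀ {n} (T : RightTransversal ⌊ H ⌋ ⌊ I ⌋ n) →
                   ∀ (h : ∃ ⟨ ⌊ H ⌋ ⟩) → proj₁ h ∈ ⟨ R H ⟩ →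
                   let module I/R = RawTopologicalGroup (⌊ I ⌋ / R I)
                   in  transfer {N = R I} T h I/R.≈ I/R.ε
        R-ind    : ∀ {I H} → I ∈𝔐ᵢ H → R I ≤ R H

    module _ (finiteIndex : ∀ {I H} → I ∈𝔐ᵣ H → FiniteIndex ⌊ H ⌋ ⌊ I ⌋)
             (𝐑 : AbelianizationSystem) where
      open AbelianizationSystem 𝐑

      π : RawMackeyFunctor ℓ
      π = record
        { Φ    = λ H → ⌊ H ⌋ / R H
        ; cast = λ (H⊆K , _) (x , p) → x , H⊆K p
        ; res  = λ {I} p → transfer {N = R I} (proj₂ (finiteIndex p))
        ; ind  = λ p (x , x∈I) → x , 𝔐⋆-≤ p x∈I
        ; con  = λ g H (h , h∈H) →
                   g ∙ h ∙ g ⁻¹ ,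
                   resp-≈ ⌊ H ⌋ (sym (conjBy-inverse g h)) h∈H
        }

{-# OPTIONS --safe #-}
module Submission where

open import Level using (Level)
open import Data.Product.Base using (proj₂)
open import Defs

open import Algebra.Bundles using (Group; AbelianGroup; CommutativeMonoid)
open import Algebra.Definitions using (Commutative)
import Algebra.Morphism.Construct.Identity as Identity
open import Algebra.Morphism.Structures using (module GroupMorphisms)
import Algebra.Properties.CommutativeMonoid.Sum as CommutativeMonoidSum
import Algebra.Properties.Group as GroupProperties
import Algebra.Properties.Monoid.Sum as MonoidSum
open import Data.Bool.Base using (Bool; true; false; not)
import Data.Bool.Properties as Bool
open import Data.Fin.Base using (Fin; zero; suc; _↑ˡ_; _↑ʳ_)
open import Data.Fin.Permutation using (Permutation; permutation)
import Data.Fin.Properties as Fin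
open import Data.List.Base using (List; []; _∷_)
open import Data.Nat.Base as ℕ using (ℕ)
open import Data.Product.Base using (Σ; ∃; _×_; _,_; proj₁; uncurry)
open import Data.Sum.Base using (_⊎_; inj₁; inj₂)
open import Data.Sum.Function.Propositional using (_⊎-↔_)
open import Data.Unit.Polymorphic.Base using (tt)
open import Data.Vec.Base using (Vec; lookup)
import Data.Vec.Functional as Vector
open import Function.Base using (_∘_; id)
open import Function.Bundles using (_↔_; Inverse; mk↔ₛ′)
open import Function.Construct.Composition using (_↔-∘_)
open import Function.Construct.Identity using (↔-id)
open import Level using (Lift; lift)
open import Relation.Binary.Core using (Rel)
open import Relation.Binary.PropositionalEquality.Core as ≡ using (_≡_; _≢_)
import Relation.Binary.Reasoning.Setoid as SetoidReasoning
import Relation.Binary.Reflection as Reflection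
open import Relation.Nullary using (yes; no; contradiction)
open import Relation.Unary using (Pred; _∈_; ∁; _⊢_)

-- For right transversals S and T of I in H put δ(S,T) = Π_j s_j t_{k(j)}⁻¹ ∈ I/N,
-- where s_j ∈ I t_{k(j)}.  Since I/N is abelian, δ(S,U) = δ(S,T) δ(T,U), and
-- δ(Sh,Th) = δ(S,T).  As the transfer of h is δ(Th,T), it is a homomorphism
-- and can be computed with any transversal S: if s_j h = b_j s_{ρ(j)} with
-- b_j ∈ I, then it is Π_j b_j.  Transitivity of the transfer and the Mackey
-- formula thus only need suitable transversals, namely products of two
-- transversals, and the h·t with h a representative of I\H/J and t in a
-- transversal of Iʰ ∩ J in J.

module GroupSolver {c ℓ} (𝓖 : Group c ℓ) where
  open Group 𝓖
  open GroupProperties 𝓖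
  open SetoidReasoning setoid

  infixl 7 _⊙_
  infix  8 _⁻

  data Expr (n : ℕ) : Set where
    var : Fin n → Expr n
    _⊙_ : Expr n → Expr n → Expr n
    _⁻  : Expr n → Expr n

  Letter : ℕ → Set
  Letter n = Bool × Fin n

  push : ∀ {n} → Letter n → List (Letter n) → List (Letter n)
  push a [] = a ∷ []
  push (s , x) ((t , y) ∷ w) with x Fin.≟ y | s Bool.≟ t
  ... | yes _ | no _  = w
  ... | yes _ | yes _ = (s , x) ∷ (t , y) ∷ w
  ... | no _  | _     = (s , x) ∷ (t , y) ∷ w

  -- The reduced word of e · w or e⁻¹ · w, according to the sign.
  normalise : ∀ {n} → Bool → Expr n → List (Letter n) → List (Letter n)
  normalise s     (var x) w = push (s , x) w
  normalise true  (a ⊙ b) w = normalise true a (normalise true b w)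
  normalise false (a ⊙ b) w = normalise false b (normalise false a w)
  normalise s     (a ⁻)   w = normalise (not s) a w

  signed : Bool → Carrier → Carrier
  signed true  x = x
  signed false x = x ⁻¹

  ⟦_⟧ : ∀ {n} → Expr n → Vec Carrier n → Carrier
  ⟦ var x ⟧ ρ = lookup ρ x
  ⟦ a ⊙ b ⟧ ρ = ⟦ a ⟧ ρ ∙ ⟦ b ⟧ ρ
  ⟦ a ⁻   ⟧ ρ = ⟦ a ⟧ ρ ⁻¹

  ⟦_⟧ʷ : ∀ {n} → List (Letter n) → Vec Carrier n → Carrier
  ⟦ [] ⟧ʷ          ρ = ε
  ⟦ (s , x) ∷ w ⟧ʷ ρ = signed s (lookup ρ x) ∙ ⟦ w ⟧ʷ ρ

  ⟦_⇓⟧ : ∀ {n} → Expr n → Vec Carrier n → Carrier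
  ⟦ e ⇓⟧ = ⟦ normalise true e [] ⟧ʷ

  push-cancel : ∀ s t x y → s ≢ t → signed s x ∙ (signed t x ∙ y) ≈ y
  push-cancel true  true  x y s≢t = contradiction ≡.refl s≢t
  push-cancel true  false x y s≢t = \\-leftDividesˡ x y
  push-cancel false true  x y s≢t = \\-leftDividesʳ x y
  push-cancel false false x y s≢t = contradiction ≡.refl s≢t

  push-correct : ∀ {n} s x w (ρ : Vec Carrier n) →
                 ⟦ push (s , x) w ⟧ʷ ρ ≈ signed s (lookup ρ x) ∙ ⟦ w ⟧ʷ ρ
  push-correct s x [] ρ = refl
  push-correct s x ((t , y) ∷ w) ρ with x Fin.≟ y | s Bool.≟ t
  ... | yes ≡.refl | no s≢t = sym (push-cancel s t (lookup ρ x) _ s≢t)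
  ... | yes _      | yes _  = refl
  ... | no _       | _      = refl

  signed-not : ∀ s x → signed (not s) x ≈ signed s (x ⁻¹)
  signed-not true  x = refl
  signed-not false x = sym (⁻¹-involutive x)

  normalise-correct : ∀ {n} s e w (ρ : Vec Carrier n) →
                      ⟦ normalise s e w ⟧ʷ ρ ≈ signed s (⟦ e ⟧ ρ) ∙ ⟦ w ⟧ʷ ρ
  normalise-correct s (var x) w ρ = push-correct s x w ρ
  normalise-correct true (a ⊙ b) w ρ = begin
    ⟦ normalise true a (normalise true b w) ⟧ʷ ρ  ≈⟨ normalise-correct true a _ ρ ⟩
    ⟦ a ⟧ ρ ∙ ⟦ normalise true b w ⟧ʷ ρ           ≈⟨ ∙-congˡ (normalise-correct true b w ρ) ⟩
    ⟦ a ⟧ ρ ∙ (⟦ b ⟧ ρ ∙ ⟦ w ⟧ʷ ρ)                ≈⟨ assoc _ _ _ ⟨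
    ⟦ a ⟧ ρ ∙ ⟦ b ⟧ ρ ∙ ⟦ w ⟧ʷ ρ                  ∎
  normalise-correct false (a ⊙ b) w ρ = begin
    ⟦ normalise false b (normalise false a w) ⟧ʷ ρ  ≈⟨ normalise-correct false b _ ρ ⟩
    ⟦ b ⟧ ρ ⁻¹ ∙ ⟦ normalise false a w ⟧ʷ ρ         ≈⟨ ∙-congˡ (normalise-correct false a w ρ) ⟩
    ⟦ b ⟧ ρ ⁻¹ ∙ (⟦ a ⟧ ρ ⁻¹ ∙ ⟦ w ⟧ʷ ρ)            ≈⟨ assoc _ _ _ ⟨
    ⟦ b ⟧ ρ ⁻¹ ∙ ⟦ a ⟧ ρ ⁻¹ ∙ ⟦ w ⟧ʷ ρ              ≈⟨ ∙-congʳ (⁻¹-anti-homo-∙ _ _) ⟨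
    (⟦ a ⟧ ρ ∙ ⟦ b ⟧ ρ) ⁻¹ ∙ ⟦ w ⟧ʷ ρ               ∎
  normalise-correct s (a ⁻) w ρ = begin
    ⟦ normalise (not s) a w ⟧ʷ ρ       ≈⟨ normalise-correct (not s) a w ρ ⟩
    signed (not s) (⟦ a ⟧ ρ) ∙ ⟦ w ⟧ʷ ρ ≈⟨ ∙-congʳ (signed-not s _) ⟩
    signed s (⟦ a ⟧ ρ ⁻¹) ∙ ⟦ w ⟧ʷ ρ    ∎

  correct : ∀ {n} (e : Expr n) ρ → ⟦ e ⇓⟧ ρ ≈ ⟦ e ⟧ ρ
  correct e ρ = trans (normalise-correct true e [] ρ) (identityʳ _)

  open Reflection setoid var ⟦_⟧ ⟦_⇓⟧ correct public using (solve; _⊜_)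

total : ∀ {n} → (Fin n → ℕ) → ℕ
total = Vector.foldr ℕ._+_ 0

⊎↔Σ : ∀ {n} (A : Fin (ℕ.suc n) → Set) → (A zero ⊎ Σ (Fin n) (A ∘ suc)) ↔ Σ (Fin (ℕ.suc n)) A
⊎↔Σ A = mk↔ₛ′ to from to-from from-to
  where
  to : A zero ⊎ Σ _ (A ∘ suc) → Σ _ A
  to (inj₁ a)       = zero , a
  to (inj₂ (k , a)) = suc k , a

  from : Σ _ A → A zero ⊎ Σ _ (A ∘ suc)
  from (zero  , a) = inj₁ a
  from (suc k , a) = inj₂ (k , a)

  to-from : ∀ x → to (from x) ≡ x
  to-from (zero  , a) = ≡.refl
  to-from (suc k , a) = ≡.refl

  from-to : ∀ x → from (to x) ≡ x
  from-to (inj₁ a) = ≡.refl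
  from-to (inj₂ a) = ≡.refl

total↔Σ : ∀ {n} (m : Fin n → ℕ) → Fin (total m) ↔ Σ (Fin n) (Fin ∘ m)
total↔Σ {ℕ.zero}  m = mk↔ₛ′ (λ ()) (λ ()) (λ ()) (λ ())
total↔Σ {ℕ.suc n} m =
  ⊎↔Σ (Fin ∘ m) ↔-∘ ((↔-id _ ⊎-↔ total↔Σ (m ∘ suc)) ↔-∘ Fin.+↔⊎)

module _ {c ℓ} (M : CommutativeMonoid c ℓ) where
  open CommutativeMonoid M
  open CommutativeMonoidSum M
  open SetoidReasoning setoid

  sum-↑ : ∀ m {n} (f : Fin (m ℕ.+ n) → Carrier) →
          sum f ≈ sum (f ∘ (_↑ˡ n)) ∙ sum (f ∘ (m ↑ʳ_))
  sum-↑ ℕ.zero    f = sym (identityˡ _)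
  sum-↑ (ℕ.suc m) f = trans (∙-congˡ (sum-↑ m (f ∘ suc))) (sym (assoc _ _ _))

  sum-total : ∀ {n} (m : Fin n → ℕ) (f : Σ (Fin n) (Fin ∘ m) → Carrier) →
              sum (f ∘ Inverse.to (total↔Σ m)) ≈ sum λ k → sum λ j → f (k , j)
  sum-total {ℕ.zero}  m f = refl
  sum-total {ℕ.suc n} m f = begin
    sum F                                            ≈⟨ sum-↑ (m zero) {N} F ⟩
    sum (F ∘ (_↑ˡ N)) ∙ sum (F ∘ (m zero ↑ʳ_))
      ≈⟨ ∙-cong (sum-cong-≋ left) (sum-cong-≋ right) ⟩
    sum (λ j → f (zero , j)) ∙
      sum (f′ ∘ Inverse.to (total↔Σ (m ∘ suc)))      ≈⟨ ∙-congˡ (sum-total (m ∘ suc) f′) ⟩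
    sum (λ k → sum λ j → f (k , j))                  ∎
    where
    N  = total (m ∘ suc)
    F  = f ∘ Inverse.to (total↔Σ m)
    f′ = λ ((k , j) : Σ (Fin n) (Fin ∘ m ∘ suc)) → f (suc k , j)

    left : ∀ j → F (j ↑ˡ N) ≈ f (zero , j)
    left j rewrite Fin.splitAt-↑ˡ (m zero) j N = refl

    right : ∀ j → F (m zero ↑ʳ j) ≈ f′ (Inverse.to (total↔Σ (m ∘ suc)) j)
    right j rewrite Fin.splitAt-↑ʳ (m zero) N j = refl

module _ {ℓ} (𝓖 : TopologicalGroup ℓ) where
  open TopologicalGroup 𝓖
  open Group group
  open GroupProperties group
  open IsTopology isTopology
  open GroupSolver group
  open Subgroup using (resp-≈; ε-closed; ∙-closed; ⁻¹-closed)
  open RawTopologicalGroup using () renaming (sum to Σ[_])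
  open GroupMorphisms using (IsGroupHomomorphism)

  open MonoidSum monoid using () renaming (sum to ∑; sum-cong-≋ to ∑-cong)

  private
    infix 6 _/ᵗ_
    _/ᵗ_ = _/_ 𝓖
    c = conjBy 𝓖

  Open-const : ∀ (P : Set ℓ) → Open (λ _ → P)
  Open-const P = Open-resp-≐ (proj₁ , (_, tt)) (Open-⋃ {A = P} (λ _ → Open-⊤))

  Open-⋂ : ∀ {n} {U : Fin n → Pred Carrier ℓ} → (∀ k → Open (U k)) → Open (λ x → ∀ k → x ∈ U k)
  Open-⋂ {ℕ.zero}  oU = Open-resp-≐ ((λ _ ()) , (λ _ → tt)) Open-⊤
  Open-⋂ {ℕ.suc n} oU = Open-resp-≐
    ((λ { (p , ps) zero → p ; (p , ps) (suc k) → ps k }) , (λ ps → ps zero , ps ∘ suc))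
    (Open-∩ (oU zero) (Open-⋂ (oU ∘ suc)))

  const-continuous : ∀ a → Continuous Open Open (λ _ → a)
  const-continuous a {V} oV = Open-const (a ∈ V)

  ∙-continuous₂ : ∀ {f g} → Continuous Open Open f → Continuous Open Open g →
                  Continuous Open Open (λ x → f x ∙ g x)
  ∙-continuous₂ {f} {g} cf cg {V} oV = Open-resp-≐ (to , from)
    (Open-⋃ {A = ∃ λ x → f x ∙ g x ∈ V} λ (_ , p) →
      let _ , _ , oU , oW , _ = ∙-continuous oV p in Open-∩ (cf oU) (cg oW))
    where
    to : ∀ {x} → Σ (∃ λ y → f y ∙ g y ∈ V) (λ (y , p) →
           let U , W , _ = ∙-continuous oV p in f x ∈ U × g x ∈ W) → f x ∙ g x ∈ V
    to ((y , p) , fx∈U , gx∈W) =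
      let _ , _ , _ , _ , _ , _ , sub = ∙-continuous oV p in sub fx∈U gx∈W

    from : ∀ {x} → f x ∙ g x ∈ V → Σ (∃ λ y → f y ∙ g y ∈ V) (λ (y , p) →
           let U , W , _ = ∙-continuous oV p in f x ∈ U × g x ∈ W)
    from {x} p = let _ , _ , _ , _ , fx∈U , gx∈W , _ = ∙-continuous oV p
                 in (x , p) , fx∈U , gx∈W

  translation-continuous : ∀ a b → Continuous Open Open (λ x → a ∙ x ∙ b)
  translation-continuous a b =
    ∙-continuous₂ (∙-continuous₂ (const-continuous a) id) (const-continuous b)

  ∑-continuous : ∀ {n} {f : Fin n → Carrier → Carrier} →
                 (∀ k → Continuous Open Open (f k)) →
                 Continuous Open Open (λ x → ∑ λ k → f k x)
  ∑-continuous {ℕ.zero}  cf = const-continuous ε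
  ∑-continuous {ℕ.suc n} cf = ∙-continuous₂ (cf zero) (∑-continuous (cf ∘ suc))

  record IsAbelianQuotient (H N : Subgroup 𝓖) : Set ℓ where
    open RawTopologicalGroup (H /ᵗ N) using () renaming (_≈_ to _∼_; _∙_ to _·_)
    field
      N≤H    : _≤_ 𝓖 N H
      normal : ∀ {h x} → h ∈ ⟨ H ⟩ → x ∈ ⟨ N ⟩ → h ∙ x ∙ h ⁻¹ ∈ ⟨ N ⟩
      ∼-comm : Commutative _∼_ _·_

  module Quotient {H N : Subgroup 𝓖} (H/N-abelian : IsAbelianQuotient H N) where
    open IsAbelianQuotient H/N-abelian public
    private module H/N = RawTopologicalGroup (H /ᵗ N)

    infix 4 _∼_
    _∼_ : Rel Carrier ℓ
    x ∼ y = x ⁻¹ ∙ y ∈ ⟨ N ⟩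

    ≈⇒∼ : ∀ {x y} → x ≈ y → x ∼ y
    ≈⇒∼ x≈y = resp-≈ N (trans (sym (inverseˡ _)) (∙-congˡ x≈y)) (ε-closed N)

    ∼-sym : ∀ {x y} → x ∼ y → y ∼ x
    ∼-sym {x} {y} p =
      resp-≈ N (solve 2 (λ x y → (x ⁻ ⊙ y) ⁻ ⊜ y ⁻ ⊙ x) refl x y) (⁻¹-closed N p)

    ∼-trans : ∀ {x y z} → x ∼ y → y ∼ z → x ∼ z
    ∼-trans {x} {y} {z} p q =
      resp-≈ N (solve 3 (λ x y z → x ⁻ ⊙ y ⊙ (y ⁻ ⊙ z) ⊜ x ⁻ ⊙ z) refl x y z) (∙-closed N p q)

    ∼-∙-cong : ∀ {x y u v} → u ∈ ⟨ H ⟩ → x ∼ y → u ∼ v → x ∙ u ∼ y ∙ v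
    ∼-∙-cong {x} {y} {u} {v} u∈H p q = resp-≈ N
      (solve 4 (λ x y u v → u ⁻ ⊙ (x ⁻ ⊙ y) ⊙ u ⁻ ⁻ ⊙ (u ⁻ ⊙ v) ⊜ (x ⊙ u) ⁻ ⊙ (y ⊙ v))
        refl x y u v)
      (∙-closed N (normal (⁻¹-closed H u∈H) p) q)

    ∼-∙-congˡ : ∀ {x y z} → y ∼ z → x ∙ y ∼ x ∙ z
    ∼-∙-congˡ {x} {y} {z} =
      resp-≈ N (solve 3 (λ x y z → y ⁻ ⊙ z ⊜ (x ⊙ y) ⁻ ⊙ (x ⊙ z)) refl x y z)

    ∼-∙-congʳ : ∀ {x y z} → x ∈ ⟨ H ⟩ → y ∼ z → y ∙ x ∼ z ∙ x
    ∼-∙-congʳ x∈H p = ∼-∙-cong x∈H p (≈⇒∼ refl)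

    ∼-⁻¹-cong : ∀ {x y} → y ∈ ⟨ H ⟩ → x ∼ y → x ⁻¹ ∼ y ⁻¹
    ∼-⁻¹-cong {x} {y} y∈H p = resp-≈ N
      (solve 2 (λ x y → y ⊙ (y ⁻ ⊙ x) ⊙ y ⁻ ⊜ x ⁻ ⁻ ⊙ y ⁻) refl x y)
      (normal y∈H (∼-sym p))

    abelianGroup : AbelianGroup ℓ ℓ
    abelianGroup = record
      { Carrier = H/N.Carrier ; _≈_ = H/N._≈_ ; _∙_ = H/N._∙_ ; ε = H/N.ε ; _⁻¹ = H/N._⁻¹
      ; isAbelianGroup = record
        { isGroup = record
          { isMonoid = record
            { isSemigroup = record
              { isMagma = record
                { isEquivalence = record
                  { refl  = ≈⇒∼ refl
                  ; sym   = ∼-sym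
                  ; trans = ∼-trans
                  }
                ; ∙-cong = λ {_} {_} {u} → ∼-∙-cong (proj₂ u)
                }
              ; assoc = λ (x , _) (y , _) (z , _) → ≈⇒∼ (assoc x y z)
              }
            ; identity = (λ (x , _) → ≈⇒∼ (identityˡ x)) , (λ (x , _) → ≈⇒∼ (identityʳ x))
            }
          ; inverse = (λ (x , _) → ≈⇒∼ (inverseˡ x)) , (λ (x , _) → ≈⇒∼ (inverseʳ x))
          ; ⁻¹-cong = λ {_} {y} → ∼-⁻¹-cong (proj₂ y)
          }
        ; comm = ∼-comm
        }
      }

    open AbelianGroup abelianGroup public
      using (commutativeMonoid)
    open CommutativeMonoidSum commutativeMonoid public
      using (sum-cong-≋; sum-permute; ∑-distrib-+; sum-replicate)

    -- The union of the translates U n⁻¹ for n ∈ N, hence open: this is why H → H/N is open.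
    saturation : Pred Carrier ℓ → Pred Carrier ℓ
    saturation U x = ∃ λ ((n , _) : ∃ ⟨ N ⟩) → x ∙ n ∈ U

    saturation-open : ∀ {U} → Open U → H/N.Open (proj₁ ⊢ saturation U)
    saturation-open {U} oU =
      (saturation U , Open-⋃ (λ (n , _) → ∙-continuous₂ id (const-continuous n) oU) , id , id) ,
      λ { {x , _} {y , _} x∼y ((n , n∈N) , xn∈U) →
        ((x ⁻¹ ∙ y) ⁻¹ ∙ n , ∙-closed N (⁻¹-closed N x∼y) n∈N) ,
        respects oU (solve 3 (λ x y n → x ⊙ n ⊜ y ⊙ ((x ⁻ ⊙ y) ⁻ ⊙ n)) refl x y n) xn∈U }

    ∈-saturation : ∀ {U x} → Open U → x ∈ U → x ∈ saturation U
    ∈-saturation oU x∈U = (ε , ε-closed N) , respects oU (sym (identityʳ _)) x∈U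

    isTopology/ : IsTopology H/N._≈_ H/N.Open
    isTopology/ = record
      { Open-resp-≐ = λ (U⊆V , V⊆U) ((U′ , oU′ , U⊆U′ , U′⊆U) , U-resp) →
          (U′ , oU′ , U⊆U′ ∘ V⊆U , U⊆V ∘ U′⊆U) , λ {x} {y} x∼y → U⊆V ∘ U-resp {x} {y} x∼y ∘ V⊆U
      ; respects    = proj₂
      ; Open-⊤      = (_ , Open-⊤ , id , id) , λ _ p → p
      ; Open-∩      = λ ((_ , oU , U⊆ , ⊆U) , U-resp) ((_ , oV , V⊆ , ⊆V) , V-resp) →
          (_ , Open-∩ oU oV , (λ (p , q) → U⊆ p , V⊆ q) , (λ (p , q) → ⊆U p , ⊆V q)) ,
          λ {x} {y} x∼y (p , q) → U-resp {x} {y} x∼y p , V-resp {x} {y} x∼y q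
      ; Open-⋃      = λ oU →
          (_ , Open-⋃ (λ a → let (_ , oU′ , _) , _ = oU a in oU′) ,
            (λ (a , p) → let (_ , _ , U⊆ , _) , _ = oU a in a , U⊆ p) ,
            (λ (a , p) → let (_ , _ , _ , ⊆U) , _ = oU a in a , ⊆U p)) ,
          λ {x} {y} x∼y (a , p) → a , proj₂ (oU a) {x} {y} x∼y p
      }

    ∙-continuous/ : Continuous (ProductOpen H/N.Open H/N.Open) H/N.Open (uncurry H/N._∙_)
    ∙-continuous/ {V} ((V′ , oV′ , V⊆V′ , V′⊆V) , V-resp) {x , x∈H} {y , y∈H} xy∈V =
      let U , W , oU , oW , x∈U , y∈W , sub = ∙-continuous oV′ (V⊆V′ xy∈V)
      in  (proj₁ ⊢ saturation U) , (proj₁ ⊢ saturation W) ,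
          saturation-open oU , saturation-open oW ,
          ∈-saturation oU x∈U , ∈-saturation oW y∈W ,
          λ { {x , x∈H} {y , y∈H} ((n , n∈N) , xn∈U) ((n′ , n′∈N) , yn′∈W) →
            V-resp
              {x ∙ n ∙ (y ∙ n′) ,
               ∙-closed H (∙-closed H x∈H (N≤H n∈N)) (∙-closed H y∈H (N≤H n′∈N))}
              {x ∙ y , ∙-closed H x∈H y∈H}
              (resp-≈ N
                (solve 4 (λ x y n n′ → n′ ⁻ ⊙ (y ⁻ ⊙ n ⁻ ⊙ y ⁻ ⁻) ⊜ (x ⊙ n ⊙ (y ⊙ n′)) ⁻ ⊙ (x ⊙ y))
                  refl x y n n′)
                (∙-closed N (⁻¹-closed N n′∈N)
                            (normal (⁻¹-closed H y∈H) (⁻¹-closed N n∈N))))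
              (V′⊆V (sub xn∈U yn′∈W)) }

    isTopologicalAbelianGroup : IsTopologicalAbelianGroup (H /ᵗ N)
    isTopologicalAbelianGroup = record
      { isTopologicalGroup = record
        { isGroup       = AbelianGroup.isGroup abelianGroup
        ; isTopology    = isTopology/
        ; ∙-continuous  = ∙-continuous/
        ; ⁻¹-continuous = λ ((_ , oV , V⊆ , ⊆V) , V-resp) →
            (_ , ⁻¹-continuous oV , V⊆ , ⊆V) ,
            λ {x} {y} x∼y → V-resp {x H/N.⁻¹} {y H/N.⁻¹} (∼-⁻¹-cong (proj₂ y) x∼y)
        }
      ; comm = ∼-comm
      }

  module _ {H N K M : Subgroup 𝓖} {φ : Carrier → Carrier}
           (φ-homo : IsGroupHomomorphism rawGroup rawGroup φ)
           (φ-continuous : Continuous Open Open φ)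
           (φ-N : ∀ {x} → x ∈ ⟨ N ⟩ → φ x ∈ ⟨ M ⟩)
           (φ-H : ∀ {x} → x ∈ ⟨ H ⟩ → φ x ∈ ⟨ K ⟩)
           (K/M-abelian : IsAbelianQuotient K M) where
    open IsGroupHomomorphism φ-homo
    open Quotient K/M-abelian using (≈⇒∼)

    private
      φ/-cong : ∀ {x y} → x ⁻¹ ∙ y ∈ ⟨ N ⟩ → φ x ⁻¹ ∙ φ y ∈ ⟨ M ⟩
      φ/-cong p = resp-≈ M (trans (homo _ _) (∙-congʳ (⁻¹-homo _))) (φ-N p)

    quotientMap : IsContinuousHomomorphism (H /ᵗ N) (K /ᵗ M) (λ (x , p) → φ x , φ-H p)
    quotientMap = record
      { isGroupHomomorphism = record
        { isMonoidHomomorphism = record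
          { isMagmaHomomorphism = record
            { isRelHomomorphism = record { cong = φ/-cong }
            ; homo = λ (x , _) (y , _) → ≈⇒∼ (homo x y)
            }
          ; ε-homo = ≈⇒∼ ε-homo
          }
        ; ⁻¹-homo = λ (x , _) → ≈⇒∼ (⁻¹-homo x)
        }
      ; continuous = λ ((_ , oV , V⊆ , ⊆V) , V-resp) →
          (_ , φ-continuous oV , V⊆ , ⊆V) ,
          λ {(x , x∈H)} {(y , y∈H)} x∼y → V-resp {φ x , φ-H x∈H} {φ y , φ-H y∈H} (φ/-cong x∼y)
      }

  id-homo : IsGroupHomomorphism rawGroup rawGroup id
  id-homo = Identity.isGroupHomomorphism rawGroup refl

  conjBy-homo : ∀ g → IsGroupHomomorphism rawGroup rawGroup (c g)
  conjBy-homo g = record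
    { isMonoidHomomorphism = record
      { isMagmaHomomorphism = record
        { isRelHomomorphism = record { cong = conjBy-cong 𝓖 refl }
        ; homo = λ x y → sym (conjBy-∙ 𝓖 g x y)
        }
      ; ε-homo = conjBy-ε 𝓖 g
      }
    ; ⁻¹-homo = λ x → sym (conjBy-⁻¹ 𝓖 g x)
    }

  sum-homo : ∀ {A : RawTopologicalGroup ℓ} {H N f} (H/N-abelian : IsAbelianQuotient H N) →
             IsContinuousHomomorphism A (H /ᵗ N) f →
             ∀ {n} (x : Fin n → RawTopologicalGroup.Carrier A) →
             RawTopologicalGroup._≈_ (H /ᵗ N) (f (Σ[ A ] x)) (Σ[ H /ᵗ N ] (f ∘ x))
  sum-homo {A} {H} {N} {f} H/N-abelian f-homo = go
    where
    open IsGroupHomomorphism (IsContinuousHomomorphism.isGroupHomomorphism f-homo)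
    open Quotient H/N-abelian

    go : ∀ {n} (x : Fin n → RawTopologicalGroup.Carrier A) →
         RawTopologicalGroup._≈_ (H /ᵗ N) (f (Σ[ A ] x)) (Σ[ H /ᵗ N ] (f ∘ x))
    go {ℕ.zero}  x = ε-homo
    go {ℕ.suc n} x = ∼-trans (homo _ _) (∼-∙-congˡ (go (x ∘ suc)))

  module _ {H I : Subgroup 𝓖} where
    open RightTransversal

    coset-unique : ∀ {n} (T : RightTransversal 𝓖 H I n) {x} (x∈H : x ∈ ⟨ H ⟩) {j} →
                   x ∙ rep T j ⁻¹ ∈ ⟨ I ⟩ → proj₁ (cover T x∈H) ≡ j
    coset-unique T {x} x∈H {j} p = let k , q = cover T x∈H in distinct T (resp-≈ I
      (solve 3 (λ x s t → (x ⊙ s ⁻) ⁻ ⊙ (x ⊙ t ⁻) ⊜ s ⊙ t ⁻) refl x (rep T k) (rep T j))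
      (∙-closed I (⁻¹-closed I q) p))

    change : ∀ {m n} → RightTransversal 𝓖 H I m → RightTransversal 𝓖 H I n → Fin m → Fin n
    change S T j = proj₁ (cover T (rep∈ S j))

    factor : ∀ {m n} → RightTransversal 𝓖 H I m → RightTransversal 𝓖 H I n → Fin m → ∃ ⟨ I ⟩
    factor S T j = let k , p = cover T (rep∈ S j) in rep S j ∙ rep T k ⁻¹ , p

    change-inverse : ∀ {m n} (S : RightTransversal 𝓖 H I m) (T : RightTransversal 𝓖 H I n) →
                     ∀ j → change S T (change T S j) ≡ j
    change-inverse S T j = coset-unique T (rep∈ S (change T S j))
      (resp-≈ I (⁻¹-anti-homo-// _ _) (⁻¹-closed I (proj₂ (factor T S j))))

    changePermutation : ∀ {m n} → RightTransversal 𝓖 H I m → RightTransversal 𝓖 H I n →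
                        Permutation m n
    changePermutation S T =
      permutation (change S T) (change T S) (change-inverse S T) (change-inverse T S)

    translate : ∀ {n} → RightTransversal 𝓖 H I n → ∃ ⟨ H ⟩ → RightTransversal 𝓖 H I n
    translate T (h , h∈H) = record
      { rep      = λ k → rep T k ∙ h
      ; rep∈     = λ k → ∙-closed H (rep∈ T k) h∈H
      ; cover    = λ {x} x∈H →
          let k , p = cover T (∙-closed H x∈H (⁻¹-closed H h∈H))
          in  k , resp-≈ I (solve 3 (λ x h t → x ⊙ h ⁻ ⊙ t ⁻ ⊜ x ⊙ (t ⊙ h) ⁻) refl x h (rep T k)) p
      ; distinct = λ {k} {l} p → distinct T (resp-≈ I
          (solve 3 (λ s h t → s ⊙ h ⊙ (t ⊙ h) ⁻ ⊜ s ⊙ t ⁻) refl (rep T k) h (rep T l)) p)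
      }

    Σ-transversal : ∀ {n} (m : Fin n → ℕ) (t : ∀ k → Fin (m k) → Carrier) →
                    (∀ k j → t k j ∈ ⟨ H ⟩) →
                    (∀ {x} → x ∈ ⟨ H ⟩ → ∃ λ k → ∃ λ j → x ∙ t k j ⁻¹ ∈ ⟨ I ⟩) →
                    (∀ {k l j j′} → t k j ∙ t l j′ ⁻¹ ∈ ⟨ I ⟩ → (k , j) ≡ (l , j′)) →
                    RightTransversal 𝓖 H I (total m)
    Σ-transversal m t t∈ t-cover t-distinct = record
      { rep      = uncurry t ∘ to
      ; rep∈     = uncurry t∈ ∘ to
      ; cover    = λ {x} x∈H →
          let k , j , p = t-cover x∈H
          in  from (k , j) ,
              ≡.subst (λ kj → x ∙ uncurry t kj ⁻¹ ∈ ⟨ I ⟩) (≡.sym (strictlyInverseˡ (k , j))) p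
      ; distinct = λ p → injective (t-distinct p)
      }
      where
      open Inverse (total↔Σ m)
      injective : ∀ {x y} → to x ≡ to y → x ≡ y
      injective {x} {y} eq =
        ≡.trans (≡.sym (strictlyInverseʳ x)) (≡.trans (≡.cong from eq) (strictlyInverseʳ y))

    image-transversal :
      ∀ {H′ I′ φ n} → IsGroupHomomorphism rawGroup rawGroup φ →
      (∀ {x} → x ∈ ⟨ H ⟩ → φ x ∈ ⟨ H′ ⟩) → (∀ {y} → y ∈ ⟨ H′ ⟩ → ∃ λ x → x ∈ ⟨ H ⟩ × φ x ≈ y) →
      (∀ {x} → x ∈ ⟨ I ⟩ → φ x ∈ ⟨ I′ ⟩) → (∀ {x} → φ x ∈ ⟨ I′ ⟩ → x ∈ ⟨ I ⟩) →
      RightTransversal 𝓖 H I n → RightTransversal 𝓖 H′ I′ n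
    image-transversal {I′ = I′} {φ} φ-homo φ-H φ-surj φ-I φ-I⁻¹ T = record
      { rep      = φ ∘ rep T
      ; rep∈     = φ-H ∘ rep∈ T
      ; cover    = λ y∈H′ →
          let x , x∈H , φx≈y = φ-surj y∈H′
              k , p = cover T x∈H
          in  k , resp-≈ I′ (trans (φ-// x (rep T k)) (∙-congʳ φx≈y)) (φ-I p)
      ; distinct = λ {k} {l} p → distinct T (φ-I⁻¹ (resp-≈ I′ (sym (φ-// (rep T k) (rep T l))) p))
      }
      where
      open IsGroupHomomorphism φ-homo
      φ-// : ∀ x y → φ (x ∙ y ⁻¹) ≈ φ x ∙ φ y ⁻¹
      φ-// x y = trans (homo _ _) (∙-congˡ (⁻¹-homo y))

  trivialTransversal : ∀ H → RightTransversal 𝓖 H H 1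
  trivialTransversal H = record
    { rep      = λ _ → ε
    ; rep∈     = λ _ → ε-closed H
    ; cover    = λ x∈H → zero , ∙-closed H x∈H (⁻¹-closed H (ε-closed H))
    ; distinct = λ { {zero} {zero} _ → ≡.refl }
    }

  module Transfer {H I N : Subgroup 𝓖} (I/N-abelian : IsAbelianQuotient I N) where
    open Quotient I/N-abelian
    open RightTransversal
    private module I/N = AbelianGroup abelianGroup

    δ : ∀ {m n} → RightTransversal 𝓖 H I m → RightTransversal 𝓖 H I n → ∃ ⟨ I ⟩
    δ S T = Σ[ I /ᵗ N ] (factor S T)

    δ-unique : ∀ {m n} (S : RightTransversal 𝓖 H I m) (T : RightTransversal 𝓖 H I n)
               (b : Fin m → ∃ ⟨ I ⟩) (ρ : Fin m → Fin n) →
               (∀ j → rep S j ≈ proj₁ (b j) ∙ rep T (ρ j)) → δ S T I/N.≈ Σ[ I /ᵗ N ] b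
    δ-unique S T b ρ eq = sum-cong-≋ λ j →
      let S/T = trans (∙-congʳ (eq j)) (//-rightDividesʳ _ _)
          j≡ρj = coset-unique T (rep∈ S j) (resp-≈ I (sym S/T) (proj₂ (b j)))
      in  ≈⇒∼ (trans (∙-congˡ (⁻¹-cong (reflexive (≡.cong (rep T) j≡ρj)))) S/T)

    δ-cocycle : ∀ {l m n} (S : RightTransversal 𝓖 H I l) (T : RightTransversal 𝓖 H I m)
                (U : RightTransversal 𝓖 H I n) → δ S U I/N.≈ δ S T I/N.∙ δ T U
    δ-cocycle S T U = begin
      δ S U
        ≈⟨ δ-unique S U (λ j → factor S T j I/N.∙ factor T U (change S T j))
             (change T U ∘ change S T)
             (λ j → solve 3 (λ s t u → s ⊜ s ⊙ t ⁻ ⊙ (t ⊙ u ⁻) ⊙ u) refl _ _ _) ⟩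
      Σ[ I /ᵗ N ] (λ j → factor S T j I/N.∙ factor T U (change S T j))
        ≈⟨ ∑-distrib-+ (factor S T) (factor T U ∘ change S T) ⟩
      δ S T I/N.∙ Σ[ I /ᵗ N ] (factor T U ∘ change S T)
        ≈⟨ ∼-∙-congˡ (sum-permute (factor T U) (changePermutation S T)) ⟨
      δ S T I/N.∙ δ T U
        ∎
      where open SetoidReasoning I/N.setoid

    δ-refl : ∀ {n} (T : RightTransversal 𝓖 H I n) → δ T T I/N.≈ I/N.ε
    δ-refl T = IP.identityʳ-unique (δ T T) (δ T T) (∼-sym (δ-cocycle T T T))
      where module IP = GroupProperties I/N.group

    δ-translate : ∀ {m n} (S : RightTransversal 𝓖 H I m) (T : RightTransversal 𝓖 H I n) h →
                  δ (translate S h) (translate T h) I/N.≈ δ S T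
    δ-translate S T (h , h∈H) = δ-unique (translate S (h , h∈H)) (translate T (h , h∈H))
      (factor S T) (change S T)
      (λ j → solve 3 (λ s t h → s ⊙ h ⊜ s ⊙ t ⁻ ⊙ (t ⊙ h)) refl (rep S j) (rep T (change S T j)) h)

    transferᴺ : ∀ {n} → RightTransversal 𝓖 H I n → ∃ ⟨ H ⟩ → ∃ ⟨ I ⟩
    transferᴺ = transfer 𝓖 {H} {I} {N}

    transfer-independent : ∀ {m n} (S : RightTransversal 𝓖 H I m) (T : RightTransversal 𝓖 H I n) →
                           ∀ h → transferᴺ T h I/N.≈ transferᴺ S h
    transfer-independent S T h = begin
      δ Th T                                    ≈⟨ δ-cocycle Th Sh T ⟩
      δ Th Sh I/N.∙ δ Sh T                      ≈⟨ ∼-∙-cong (proj₂ (δ Sh T))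
                                                     (δ-translate T S h) (δ-cocycle Sh S T) ⟩
      δ T S I/N.∙ (δ Sh S I/N.∙ δ S T)          ≈⟨ ∼-∙-congˡ (I/N.comm (δ Sh S) (δ S T)) ⟩
      δ T S I/N.∙ (δ S T I/N.∙ δ Sh S)          ≈⟨ I/N.assoc (δ T S) (δ S T) (δ Sh S) ⟨
      δ T S I/N.∙ δ S T I/N.∙ δ Sh S            ≈⟨ ∼-∙-congʳ (proj₂ (δ Sh S)) (δ-cocycle T S T) ⟨
      δ T T I/N.∙ δ Sh S                        ≈⟨ ∼-∙-congʳ (proj₂ (δ Sh S)) (δ-refl T) ⟩
      I/N.ε I/N.∙ δ Sh S                        ≈⟨ I/N.identityˡ (δ Sh S) ⟩
      δ Sh S                                    ∎
      where
      open SetoidReasoning I/N.setoid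
      Sh = translate S h
      Th = translate T h

    transfer-unique : ∀ {m n} (T : RightTransversal 𝓖 H I n) (S : RightTransversal 𝓖 H I m) h
                      (b : Fin m → ∃ ⟨ I ⟩) (ρ : Fin m → Fin m) →
                      (∀ j → rep S j ∙ proj₁ h ≈ proj₁ (b j) ∙ rep S (ρ j)) →
                      transferᴺ T h I/N.≈ Σ[ I /ᵗ N ] b
    transfer-unique T S h b ρ eq =
      ∼-trans (transfer-independent S T h) (δ-unique (translate S h) S b ρ eq)

    transfer-cong : ∀ {n} (T : RightTransversal 𝓖 H I n) {x y} → proj₁ x ≈ proj₁ y →
                    transferᴺ T x I/N.≈ transferᴺ T y
    transfer-cong T {x} {y} x≈y = transfer-unique T T x
      (κ 𝓖 {N = N} T y) (change (translate T y) T)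
      (λ j → trans (∙-congˡ x≈y) (sym (//-rightDividesˡ _ _)))

    transfer-∙ : ∀ {n} (T : RightTransversal 𝓖 H I n) (x y : ∃ ⟨ H ⟩)
                 (xy∈H : proj₁ x ∙ proj₁ y ∈ ⟨ H ⟩) →
                 transferᴺ T (proj₁ x ∙ proj₁ y , xy∈H) I/N.≈ transferᴺ T x I/N.∙ transferᴺ T y
    transfer-∙ T x y xy∈H = begin
      δ (translate T (proj₁ x ∙ proj₁ y , xy∈H)) T
        ≈⟨ δ-unique (translate T (proj₁ x ∙ proj₁ y , xy∈H)) T (factor Txy T) (change Txy T)
             (λ j → trans (sym (assoc _ _ _)) (sym (//-rightDividesˡ _ _))) ⟩
      δ Txy T
        ≈⟨ δ-cocycle Txy Ty T ⟩
      δ Txy Ty I/N.∙ δ Ty T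
        ≈⟨ ∼-∙-congʳ (proj₂ (δ Ty T)) (δ-translate Tx T y) ⟩
      δ Tx T I/N.∙ δ Ty T
        ∎
      where
      open SetoidReasoning I/N.setoid
      Tx = translate T x
      Ty = translate T y
      Txy = translate Tx y

    transfer-Σ : ∀ {n p} (T : RightTransversal 𝓖 H I p)
                 (m : Fin n → ℕ) (t : ∀ k → Fin (m k) → Carrier) →
                 (∀ k j → t k j ∈ ⟨ H ⟩) →
                 (∀ {x} → x ∈ ⟨ H ⟩ → ∃ λ k → ∃ λ j → x ∙ t k j ⁻¹ ∈ ⟨ I ⟩) →
                 (∀ {k l j j′} → t k j ∙ t l j′ ⁻¹ ∈ ⟨ I ⟩ → (k , j) ≡ (l , j′)) →
                 ∀ h (b : ∀ k → Fin (m k) → ∃ ⟨ I ⟩) (ρ : ∀ k → Fin (m k) → Σ (Fin n) (Fin ∘ m)) →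
                 (∀ k j → t k j ∙ proj₁ h ≈ proj₁ (b k j) ∙ uncurry t (ρ k j)) →
                 transferᴺ T h I/N.≈ Σ[ I /ᵗ N ] (λ k → Σ[ I /ᵗ N ] (b k))
    transfer-Σ T m t t∈ t-cover t-distinct h b ρ eq = ∼-trans
      (transfer-unique T (Σ-transversal m t t∈ t-cover t-distinct) h
        (uncurry b ∘ to) (from ∘ uncurry ρ ∘ to)
        (λ j → trans (uncurry eq (to j))
          (∙-congˡ (reflexive (≡.cong (uncurry t) (≡.sym (strictlyInverseˡ _)))))))
      (sum-total commutativeMonoid m (uncurry b))
      where open Inverse (total↔Σ m)

    proj₁-sum : ∀ {n} (f : Fin n → ∃ ⟨ I ⟩) → proj₁ (Σ[ I /ᵗ N ] f) ≡ ∑ (proj₁ ∘ f)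
    proj₁-sum {ℕ.zero}  f = ≡.refl
    proj₁-sum {ℕ.suc n} f = ≡.cong (proj₁ (f zero) ∙_) (proj₁-sum (f ∘ suc))

    -- The preimage of V under the transfer is cut up according to the
    -- permutation s induced by h.  Given s, the transfer is a product of
    -- translates of h, and as I is closed of finite index, that h induces s is
    -- the open condition t_k h ∉ I t_j for all j ≢ s k.
    module _ (I-closed : IsClosed 𝓖 I) {n} (T : RightTransversal 𝓖 H I n) where
      private
        t : Fin n → Carrier
        t = rep T

        piece : Pred Carrier ℓ → (Fin n → Fin n) → Pred Carrier ℓ
        piece V s h = (∀ k j → j ≢ s k → t k ∙ h ∙ t j ⁻¹ ∈ ∁ ⟨ I ⟩) ×
                      ∑ (λ k → t k ∙ h ∙ t (s k) ⁻¹) ∈ V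

        avoid-open : ∀ k j l → Open (λ h → j ≢ l → t k ∙ h ∙ t j ⁻¹ ∈ ∁ ⟨ I ⟩)
        avoid-open k j l with j Fin.≟ l
        ... | yes j≡l = Open-resp-≐ ((λ _ j≢l → contradiction j≡l j≢l) , (λ _ → tt)) Open-⊤
        ... | no j≢l  = Open-resp-≐ ((λ p _ → p) , (λ p → p j≢l))
                                    (translation-continuous (t k) (t j ⁻¹) I-closed)

        piece-open : ∀ {V} → Open V → ∀ s → Open (piece V s)
        piece-open oV s = Open-∩
          (Open-⋂ λ k → Open-⋂ λ j → avoid-open k j (s k))
          (∑-continuous (λ k → translation-continuous (t k) (t (s k) ⁻¹)) oV)

      transfer-continuous : ∀ {V} → RawTopologicalGroup.Open (I /ᵗ N) V →
                            SubspaceOpen Open ⟨ H ⟩ (transferᴺ T ⊢ V)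
      transfer-continuous {V} ((V′ , oV′ , V⊆V′ , V′⊆V) , _) =
        _ , Open-⋃ {A = Lift ℓ (Fin n → Fin n)} (λ (lift s) → piece-open oV′ s) , to , from
        where
        σ : ∃ ⟨ H ⟩ → Fin n → Fin n
        σ h = change (translate T h) T

        to : ∀ {h} → transferᴺ T h ∈ V →
             Σ (Lift ℓ (Fin n → Fin n)) λ (lift s) → piece V′ s (proj₁ h)
        to {h} p = lift (σ h) ,
          (λ k j j≢σk th∈It → j≢σk (≡.sym
            (coset-unique T (rep∈ (translate T h) k) th∈It))) ,
          ≡.subst V′ (proj₁-sum (factor (translate T h) T)) (V⊆V′ p)

        from : ∀ {h} → (Σ (Lift ℓ (Fin n → Fin n)) λ (lift s) → piece V′ s (proj₁ h)) →
               transferᴺ T h ∈ V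
        from {h} (lift s , avoid , p) = V′⊆V (≡.subst V′ (≡.sym (proj₁-sum (factor Th T)))
          (respects oV′ (∑-cong λ k → ∙-congˡ (⁻¹-cong (reflexive (≡.cong t (s≡σ k))))) p))
          where
          Th = translate T h

          s≡σ : ∀ k → s k ≡ σ h k
          s≡σ k with σ h k Fin.≟ s k
          ... | yes σk≡sk = ≡.sym σk≡sk
          ... | no  σk≢sk = contradiction (proj₂ (factor Th T k)) (avoid k (σ h k) σk≢sk)

      transfer-continuousHomomorphism :
        ∀ {M} (H/M-abelian : IsAbelianQuotient H M) →
        (∀ h → proj₁ h ∈ ⟨ M ⟩ → transferᴺ T h I/N.≈ I/N.ε) →
        IsContinuousHomomorphism (H /ᵗ M) (I /ᵗ N) (transferᴺ T)
      transfer-continuousHomomorphism {M} H/M-abelian M⊆ker = record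
        { isGroupHomomorphism = record
          { isMonoidHomomorphism = record
            { isMagmaHomomorphism = record
              { isRelHomomorphism = record { cong = λ {x} {y} → cong {x} {y} }
              ; homo = homo
              }
            ; ε-homo = M⊆ker (ε , ε-closed H) (ε-closed M)
            }
          ; ⁻¹-homo = λ (x , x∈H) → IP.inverseʳ-unique (transferᴺ T (x , x∈H))
              (transferᴺ T (x ⁻¹ , ⁻¹-closed H x∈H)) (∼-trans
              (∼-sym (homo (x , x∈H) (x ⁻¹ , ⁻¹-closed H x∈H)))
              (M⊆ker (x ∙ x ⁻¹ , _) (resp-≈ M (sym (inverseʳ x)) (ε-closed M))))
          }
        ; continuous = λ {V} oV@(_ , V-resp) →
            transfer-continuous oV ,
            λ {x} {y} x∼y → V-resp {transferᴺ T x} {transferᴺ T y} (cong {x} {y} x∼y)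
        }
        where
        module IP = GroupProperties I/N.group

        homo : ∀ x y → transferᴺ T (proj₁ x ∙ proj₁ y , ∙-closed H (proj₂ x) (proj₂ y)) I/N.≈
                       transferᴺ T x I/N.∙ transferᴺ T y
        homo x y = transfer-∙ T x y _

        cong : ∀ {x y} → proj₁ x ⁻¹ ∙ proj₁ y ∈ ⟨ M ⟩ → transferᴺ T x I/N.≈ transferᴺ T y
        cong {x , x∈H} {y , y∈H} x⁻¹y∈M = ∼-sym (begin
          transferᴺ T (y , y∈H)
            ≈⟨ transfer-cong T {y , y∈H} {x ∙ x⁻¹y , xx⁻¹y∈H} (sym (\\-leftDividesˡ x y)) ⟩
          transferᴺ T (x ∙ x⁻¹y , xx⁻¹y∈H)
            ≈⟨ transfer-∙ T (x , x∈H) (x⁻¹y , x⁻¹y∈H) xx⁻¹y∈H ⟩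
          transferᴺ T (x , x∈H) I/N.∙ transferᴺ T (x⁻¹y , x⁻¹y∈H)
            ≈⟨ ∼-∙-congˡ (M⊆ker (x⁻¹y , x⁻¹y∈H) x⁻¹y∈M) ⟩
          transferᴺ T (x , x∈H) I/N.∙ I/N.ε
            ≈⟨ I/N.identityʳ (transferᴺ T (x , x∈H)) ⟩
          transferᴺ T (x , x∈H)
            ∎)
          where
          open SetoidReasoning I/N.setoid
          x⁻¹y = x ⁻¹ ∙ y
          x⁻¹y∈H = ∙-closed H (⁻¹-closed H x∈H) y∈H
          xx⁻¹y∈H = ∙-closed H x∈H x⁻¹y∈H

  transfer-natural :
    ∀ {H I N H′ I′ N′ φ} (φ-homo : IsGroupHomomorphism rawGroup rawGroup φ)
    {φ-I : ∀ {x} → x ∈ ⟨ I ⟩ → φ x ∈ ⟨ I′ ⟩}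
    (I′/N′-abelian : IsAbelianQuotient I′ N′)
    (φ/ : IsContinuousHomomorphism (I /ᵗ N) (I′ /ᵗ N′) (λ (x , p) → φ x , φ-I p)) →
    (φ-H : ∀ {x} → x ∈ ⟨ H ⟩ → φ x ∈ ⟨ H′ ⟩) →
    (∀ {y} → y ∈ ⟨ H′ ⟩ → ∃ λ x → x ∈ ⟨ H ⟩ × φ x ≈ y) →
    (∀ {x} → φ x ∈ ⟨ I′ ⟩ → x ∈ ⟨ I ⟩) →
    ∀ {n n′} (T : RightTransversal 𝓖 H I n) (T′ : RightTransversal 𝓖 H′ I′ n′) (h : ∃ ⟨ H ⟩) →
    RawTopologicalGroup._≈_ (I′ /ᵗ N′)
      (let y , p = transfer 𝓖 {N = N} T h in φ y , φ-I p)
      (transfer 𝓖 {N = N′} T′ (φ (proj₁ h) , φ-H (proj₂ h)))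
  transfer-natural {N = N} {φ = φ} φ-homo {φ-I} I′/N′-abelian φ/ φ-H φ-surj φ-I⁻¹ T T′ h = ∼-trans
    (sum-homo I′/N′-abelian φ/ (κ 𝓖 {N = N} T h))
    (∼-sym (transfer-unique T′ (image-transversal φ-homo φ-H φ-surj φ-I φ-I⁻¹ T)
      (φ (proj₁ h) , φ-H (proj₂ h)) (λ k → let y , p = κ 𝓖 {N = N} T h k in φ y , φ-I p)
      (change (translate T h) T)
      (λ j → trans (sym (homo _ _)) (trans (⟦⟧-cong (sym (//-rightDividesˡ _ _))) (homo _ _)))))
    where
    open IsGroupHomomorphism φ-homo
    open Quotient I′/N′-abelian
    open Transfer I′/N′-abelian

  transfer-transitive :
    ∀ {H I J N M : Subgroup 𝓖} (J/M-abelian : IsAbelianQuotient J M) →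
    _≤_ 𝓖 I H → _≤_ 𝓖 J I →
    ∀ {n m l} (T : RightTransversal 𝓖 H I n) (S : RightTransversal 𝓖 I J m)
      (U : RightTransversal 𝓖 H J l) →
    IsContinuousHomomorphism (I /ᵗ N) (J /ᵗ M) (transfer 𝓖 {N = M} S) →
    ∀ h → RawTopologicalGroup._≈_ (J /ᵗ M)
      (transfer 𝓖 {N = M} S (transfer 𝓖 {N = N} T h)) (transfer 𝓖 {N = M} U h)
  transfer-transitive {H} {I} {J} {N} {M} J/M-abelian I≤H J≤I {m = m} T S U S-homo h = ∼-trans
    (sum-homo J/M-abelian S-homo (κ 𝓖 {N = N} T h))
    (∼-sym (transfer-Σ U (λ _ → m) (λ k j → S.rep j ∙ T.rep k)
      (λ k j → ∙-closed H (I≤H (S.rep∈ j)) (T.rep∈ k))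
      st-cover st-distinct h
      (λ k → κ 𝓖 {N = M} S (κh k))
      (λ k j → change (translate T h) T k , change (translate S (κh k)) S j)
      (λ k j → solve 5 (λ s t x s′ t′ → s ⊙ t ⊙ x ⊜ s ⊙ (t ⊙ x ⊙ t′ ⁻) ⊙ s′ ⁻ ⊙ (s′ ⊙ t′)) refl
        (S.rep j) (T.rep k) (proj₁ h)
        (S.rep (change (translate S (κh k)) S j)) (T.rep (change (translate T h) T k)))))
    where
    open Quotient J/M-abelian
    open Transfer J/M-abelian
    module S = RightTransversal S
    module T = RightTransversal T

    κh : ∀ k → ∃ ⟨ I ⟩
    κh = κ 𝓖 {N = N} T h

    st-cover : ∀ {x} → x ∈ ⟨ H ⟩ → ∃ λ k → ∃ λ j → x ∙ (S.rep j ∙ T.rep k) ⁻¹ ∈ ⟨ J ⟩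
    st-cover {x} x∈H =
      let k , xt⁻¹∈I = T.cover x∈H
          j , xt⁻¹s⁻¹∈J = S.cover xt⁻¹∈I
      in  k , j , resp-≈ J
            (solve 3 (λ x s t → x ⊙ t ⁻ ⊙ s ⁻ ⊜ x ⊙ (s ⊙ t) ⁻) refl x (S.rep j) (T.rep k))
            xt⁻¹s⁻¹∈J

    st-distinct : ∀ {k l j j′} → S.rep j ∙ T.rep k ∙ (S.rep j′ ∙ T.rep l) ⁻¹ ∈ ⟨ J ⟩ →
                  _≡_ {A = Σ _ λ _ → Fin m} (k , j) (l , j′)
    st-distinct {k} {l} {j} {j′} p with T.distinct {k} {l} (resp-≈ I
      (solve 4 (λ s t s′ t′ → s ⁻ ⊙ (s ⊙ t ⊙ (s′ ⊙ t′) ⁻) ⊙ s′ ⊜ t ⊙ t′ ⁻) refl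
        (S.rep j) (T.rep k) (S.rep j′) (T.rep l))
      (∙-closed I (∙-closed I (⁻¹-closed I (S.rep∈ j)) (J≤I p)) (S.rep∈ j′)))
    ... | ≡.refl = ≡.cong (k ,_) (S.distinct (resp-≈ J
      (solve 3 (λ s t s′ → s ⊙ t ⊙ (s′ ⊙ t) ⁻ ⊜ s ⊙ s′ ⁻) refl (S.rep j) (T.rep k) (S.rep j′)) p))

  -- The reps t_k and t_{σ k} cancel in the abelian quotient H/M.
  factors-product :
    ∀ {H I M N : Subgroup 𝓖} (H/M-abelian : IsAbelianQuotient H M) (I≤H : _≤_ 𝓖 I H)
    {n} (T : RightTransversal 𝓖 H I n) (h : ∃ ⟨ H ⟩) →
    RawTopologicalGroup._≈_ (H /ᵗ M)
      (Σ[ H /ᵗ M ] (λ k → let x , x∈I = κ 𝓖 {N = N} T h k in x , I≤H x∈I))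
      (RawTopologicalGroup._·_ (H /ᵗ M) n h)
  factors-product {H} {I} {M} {N} H/M-abelian I≤H {n} T h =
    HP.∙-cancelʳ (Σ[ H /ᵗ M ] t) (Σ[ H /ᵗ M ] κh) (RawTopologicalGroup._·_ (H /ᵗ M) n h) (begin
      Σ[ H /ᵗ M ] κh H/M.∙ Σ[ H /ᵗ M ] t
        ≈⟨ ∼-∙-congˡ (sum-permute t (changePermutation Th T)) ⟩
      Σ[ H /ᵗ M ] κh H/M.∙ Σ[ H /ᵗ M ] (t ∘ change Th T)
        ≈⟨ ∑-distrib-+ κh (t ∘ change Th T) ⟨
      Σ[ H /ᵗ M ] (λ k → κh k H/M.∙ t (change Th T k))
        ≈⟨ sum-cong-≋ (λ k → ∼-trans (≈⇒∼ (//-rightDividesˡ _ _)) (∼-comm (t k) h)) ⟩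
      Σ[ H /ᵗ M ] (λ k → h H/M.∙ t k)
        ≈⟨ ∑-distrib-+ (λ _ → h) t ⟩
      Σ[ H /ᵗ M ] (λ (_ : Fin n) → h) H/M.∙ Σ[ H /ᵗ M ] t
        ≈⟨ ∼-∙-congʳ (proj₂ (Σ[ H /ᵗ M ] t)) (sum-replicate n {h}) ⟩
      RawTopologicalGroup._·_ (H /ᵗ M) n h H/M.∙ Σ[ H /ᵗ M ] t
        ∎)
    where
    open Quotient H/M-abelian
    module H/M = AbelianGroup abelianGroup
    module HP = GroupProperties H/M.group
    open SetoidReasoning H/M.setoid
    Th = translate T h

    t : Fin n → ∃ ⟨ H ⟩
    t k = RightTransversal.rep T k , RightTransversal.rep∈ T k

    κh : Fin n → ∃ ⟨ H ⟩
    κh k = let x , x∈I = κ 𝓖 {N = N} T h k in x , I≤H x∈I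

  module _ {m} (𝔐 : MackeySystem 𝓖 m)
           (closed : ∀ H → IsClosed 𝓖 (MackeySystem.⌊_⌋ 𝔐 H))
           (finiteIndex : ∀ {I H} → MackeySystem._∈𝔐ᵣ_ 𝔐 I H → FiniteIndex 𝓖 (proj₁ H) (proj₁ I))
           (𝐑 : AbelianizationSystem 𝓖 𝔐) where
    open MackeySystem 𝔐
    open AbelianizationSystem 𝐑
    open RawMackeyFunctor (π 𝓖 𝔐 finiteIndex 𝐑)

    private
      T : ∀ {I H} (p : I ∈𝔐ᵣ H) → RightTransversal 𝓖 ⌊ H ⌋ ⌊ I ⌋ (proj₁ (finiteIndex p))
      T p = proj₂ (finiteIndex p)

      H/R : ∀ H → IsAbelianQuotient ⌊ H ⌋ (R H)
      H/R H = record { N≤H = R≤ H ; normal = R-normal H ; ∼-comm = R-abelian H }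

      module Q (H : Member) = Quotient (H/R H)

      cast-TAb : ∀ {H K} (e : _≋_ 𝓖 ⌊ H ⌋ ⌊ K ⌋) →
                 IsContinuousHomomorphism (Φ H) (Φ K) (cast {H} {K} e)
      cast-TAb {H} {K} e = quotientMap {⌊ H ⌋} {R H} id-homo id
        (proj₁ (R-resp-≋ {H} {K} e)) (proj₁ e) (H/R K)

      res-TAb : ∀ {I H} (p : I ∈𝔐ᵣ H) → IsContinuousHomomorphism (Φ H) (Φ I) (res p)
      res-TAb {I} {H} p =
        Transfer.transfer-continuousHomomorphism (H/R I) (closed I) (T p) (H/R H) (R-res p (T p))

      ind-TAb : ∀ {I H} (p : I ∈𝔐ᵢ H) → IsContinuousHomomorphism (Φ I) (Φ H) (ind p)
      ind-TAb {I} {H} p = quotientMap {⌊ I ⌋} {R I} id-homo id (R-ind p) (𝔐⋆-≤ p) (H/R H)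

      con-R : ∀ g H {x} → x ∈ ⟨ R H ⟩ → c g x ∈ ⟨ R (conjᴹ g H) ⟩
      con-R g H p = proj₂ (R-conj g H) (resp-≈ (R H) (sym (conjBy-inverse 𝓖 g _)) p)

      ∈-conj : ∀ g (H : Subgroup 𝓖) {x} → x ∈ ⟨ H ⟩ → c g x ∈ ⟨ conj 𝓖 g H ⟩
      ∈-conj g H p = resp-≈ H (sym (conjBy-inverse 𝓖 g _)) p

      con-TAb : ∀ g H → IsContinuousHomomorphism (Φ H) (Φ (conjᴹ g H)) (con g H)
      con-TAb g H = quotientMap {⌊ H ⌋} {R H} (conjBy-homo g) (translation-continuous g (g ⁻¹))
        (con-R g H) (∈-conj g ⌊ H ⌋) (H/R (conjᴹ g H))

      res-cast : ∀ {I I′ H H′} (e : _≋_ 𝓖 ⌊ I ⌋ ⌊ I′ ⌋) (e′ : _≋_ 𝓖 ⌊ H ⌋ ⌊ H′ ⌋)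
                 (p : I ∈𝔐ᵣ H) (p′ : I′ ∈𝔐ᵣ H′) x →
                 RawTopologicalGroup._≈_ (Φ I′)
                   (cast {I} {I′} e (res p x)) (res p′ (cast {H} {H′} e′ x))
      res-cast {I} {I′} {H} {H′} e e′ p p′ x = transfer-natural {N = R I} id-homo (H/R I′)
        (cast-TAb {I} {I′} e) (proj₁ e′) (λ y∈H′ → _ , proj₂ e′ y∈H′ , refl) (proj₂ e)
        (T p) (T p′) x

      con-res : ∀ g {I H} (p : I ∈𝔐ᵣ H) x →
                RawTopologicalGroup._≈_ (Φ (conjᴹ g I))
                  (con g I (res p x)) (res (𝔐⋆-conj g p) (con g H x))
      con-res g {I} {H} p x = transfer-natural {N = R I} (conjBy-homo g) (H/R (conjᴹ g I))
        (con-TAb g I) (∈-conj g ⌊ H ⌋)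
        (λ {y} p → c (g ⁻¹) y , p , solve 2 (λ g y → g ⊙ (g ⁻ ⊙ y ⊙ g ⁻ ⁻) ⊙ g ⁻ ⊜ y) refl g y)
        (resp-≈ ⌊ I ⌋ (conjBy-inverse 𝓖 g _))
        (T p) (T (𝔐⋆-conj g p)) x

      con-id : ∀ {h} H (h∈H : h ∈ ⟨ ⌊ H ⌋ ⟩) (x : ∣Φ H ∣) → Q._∼_ H (c h (proj₁ x)) (proj₁ x)
      con-id {h} H h∈H (x , x∈H) = ∼-trans (≈⇒∼ (assoc h x (h ⁻¹)))
        (∼-trans (∼-comm (h , h∈H) (x ∙ h ⁻¹ , ∙-closed ⌊ H ⌋ x∈H (⁻¹-closed ⌊ H ⌋ h∈H)))
                 (≈⇒∼ (//-rightDividesˡ h x)))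
        where open Q H

      mackey : ∀ {I J H} (p : I ∈𝔐ᵣ H) (q : J ∈𝔐ᵢ H) {n}
               (D : DoubleCosetRepresentatives 𝓖 ⌊ I ⌋ ⌊ H ⌋ ⌊ J ⌋ n) →
               let open DoubleCosetRepresentatives D in ∀ x →
               RawTopologicalGroup._≈_ (Φ I)
                 (res p (ind q x))
                 (Σ[ Φ I ] λ k →
                   let Iʰ∩Jₖ = Iʰ∩J 𝓖 𝔐 p q (rep∈ k)
                       I∩ʰJₖ = I∩ʰJ 𝓖 𝔐 p q (rep∈ k)
                   in  ind (I∩ʰJ∈𝔐ᵢ 𝓖 𝔐 p q (rep∈ k))
                         (cast {conjᴹ (rep k) Iʰ∩Jₖ} {I∩ʰJₖ}
                               (conj-⊓ 𝓖 (rep k) ⌊ I ⌋ ⌊ J ⌋)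
                           (con (rep k) Iʰ∩Jₖ
                             (res (Iʰ∩J∈𝔐ᵣ 𝓖 𝔐 p q (rep∈ k)) x))))
      mackey {I} {J} {H} p q {n} D x = ∼-trans
        (transfer-Σ (T p) (λ k → proj₁ (finiteIndex (Kr k))) (λ k j → rep k ∙ t k j)
          (λ k j → ∙-closed ⌊ H ⌋ (rep∈ k) (𝔐⋆-≤ q (S.rep∈ k j)))
          ht-cover ht-distinct (ind q x)
          (λ k → f k ∘ κx k) (λ k j → k , σx k j)
          (λ k j → solve 4 (λ h t x t′ → h ⊙ t ⊙ x ⊜ h ⊙ (t ⊙ x ⊙ t′ ⁻) ⊙ h ⁻ ⊙ (h ⊙ t′)) refl
            (rep k) (t k j) (proj₁ x) (t k (σx k j))))
        (∼-sym (sum-cong-≋ (λ k → sum-homo (H/R I) (f-TAb k) (κx k))))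
        where
        open DoubleCosetRepresentatives D
        open Quotient (H/R I)
        open Transfer {⌊ H ⌋} (H/R I)

        K L : Fin n → Member
        K k = Iʰ∩J 𝓖 𝔐 p q (rep∈ k)
        L k = I∩ʰJ 𝓖 𝔐 p q (rep∈ k)

        Kr : ∀ k → K k ∈𝔐ᵣ J
        Kr k = Iʰ∩J∈𝔐ᵣ 𝓖 𝔐 p q (rep∈ k)

        Li : ∀ k → L k ∈𝔐ᵢ I
        Li k = I∩ʰJ∈𝔐ᵢ 𝓖 𝔐 p q (rep∈ k)

        ʰK≋L : ∀ k → _≋_ 𝓖 ⌊ conjᴹ (rep k) (K k) ⌋ ⌊ L k ⌋
        ʰK≋L k = conj-⊓ 𝓖 (rep k) ⌊ I ⌋ ⌊ J ⌋

        module S (k : Fin n) = RightTransversal (T (Kr k))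

        t : ∀ k → Fin (proj₁ (finiteIndex (Kr k))) → Carrier
        t = S.rep

        κx : ∀ k → Fin (proj₁ (finiteIndex (Kr k))) → ∣Φ K k ∣
        κx k = κ 𝓖 {N = R (K k)} (T (Kr k)) x

        σx : ∀ k → Fin (proj₁ (finiteIndex (Kr k))) → Fin (proj₁ (finiteIndex (Kr k)))
        σx k = change (translate (T (Kr k)) x) (T (Kr k))

        f : ∀ k → ∣Φ K k ∣ → ∣Φ I ∣
        f k y = ind (Li k) (cast {conjᴹ (rep k) (K k)} {L k} (ʰK≋L k) (con (rep k) (K k) y))

        f-TAb : ∀ k → IsContinuousHomomorphism (Φ (K k)) (Φ I) (f k)
        f-TAb k = quotientMap {⌊ K k ⌋} {R (K k)} (conjBy-homo (rep k))
          (translation-continuous (rep k) (rep k ⁻¹))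
          (λ y∈R → R-ind (Li k)
            (proj₁ (R-resp-≋ {conjᴹ (rep k) (K k)} {L k} (ʰK≋L k)) (con-R (rep k) (K k) y∈R)))
          (λ y∈K → 𝔐⋆-≤ (Li k) (proj₁ (ʰK≋L k) (∈-conj (rep k) ⌊ K k ⌋ y∈K)))
          (H/R I)

        ht-cover : ∀ {x} → x ∈ ⟨ ⌊ H ⌋ ⟩ → ∃ λ k → ∃ λ j → x ∙ (rep k ∙ t k j) ⁻¹ ∈ ⟨ ⌊ I ⌋ ⟩
        ht-cover {x} x∈H =
          let k , a , b , a∈I , b∈J , x≈ahb = cover x∈H
              j , bt⁻¹∈Iʰ , _ = S.cover k b∈J
          in  k , j , resp-≈ ⌊ I ⌋
                (trans (solve 4 (λ a b h t → a ⊙ (h ⁻ ⁻ ⊙ (b ⊙ t ⁻) ⊙ h ⁻ ⁻ ⁻) ⊜ a ⊙ h ⊙ b ⊙ (h ⊙ t) ⁻)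
                         refl a b (rep k) (t k j))
                       (∙-congʳ (sym x≈ahb)))
                (∙-closed ⌊ I ⌋ a∈I bt⁻¹∈Iʰ)

        t-distinct : ∀ {k l j j′} → k ≡ l → rep k ∙ t k j ∙ (rep l ∙ t l j′) ⁻¹ ∈ ⟨ ⌊ I ⌋ ⟩ →
                     (k , j) ≡ (l , j′)
        t-distinct {k} {_} {j} {j′} ≡.refl u∈I = ≡.cong (k ,_) (S.distinct k
          ( resp-≈ ⌊ I ⌋
              (solve 3 (λ h t t′ → h ⊙ t ⊙ (h ⊙ t′) ⁻ ⊜ h ⁻ ⁻ ⊙ (t ⊙ t′ ⁻) ⊙ h ⁻ ⁻ ⁻) refl
                (rep k) (t k j) (t k j′))
              u∈I
          , ∙-closed ⌊ J ⌋ (S.rep∈ k j) (⁻¹-closed ⌊ J ⌋ (S.rep∈ k j′)) ))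

        ht-distinct : ∀ {k l j j′} → rep k ∙ t k j ∙ (rep l ∙ t l j′) ⁻¹ ∈ ⟨ ⌊ I ⌋ ⟩ →
                      (k , j) ≡ (l , j′)
        ht-distinct {k} {l} {j} {j′} u∈I = t-distinct
          (distinct
            ( _ , _ , ⁻¹-closed ⌊ I ⌋ u∈I
            , ∙-closed ⌊ J ⌋ (S.rep∈ k j) (⁻¹-closed ⌊ J ⌋ (S.rep∈ l j′))
            , solve 4 (λ h t h′ t′ → h′ ⊜ (h ⊙ t ⊙ (h′ ⊙ t′) ⁻) ⁻ ⊙ h ⊙ (t ⊙ t′ ⁻)) refl
                (rep k) (t k j) (rep l) (t l j′) ))
          u∈I

      cohomological : IsCohomological 𝓖 𝔐 (π 𝓖 𝔐 finiteIndex 𝐑)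
      cohomological {I} {H} p q S x = ∼-trans
        (⟦⟧-cong {res p x} {transfer 𝓖 {N = R I} S x}
          (Transfer.transfer-independent (H/R I) S (T p) x))
        (∼-trans (sum-homo (H/R H) (ind-TAb q) (κ 𝓖 {N = R I} S x))
                 (factors-product {N = R I} (H/R H) (𝔐⋆-≤ q) S x))
        where
        open Q H
        open IsGroupHomomorphism
          (IsContinuousHomomorphism.isGroupHomomorphism (ind-TAb q)) using (⟦⟧-cong)

    π-isCohomologicalMackeyFunctor : IsCohomologicalMackeyFunctor 𝓖 𝔐 (π 𝓖 𝔐 finiteIndex 𝐑)
    π-isCohomologicalMackeyFunctor = record
      { isMackeyFunctor = record
        { Φ-TAb      = Q.isTopologicalAbelianGroup
        ; cast-TAb   = λ {H} {K} → cast-TAb {H} {K}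
        ; res-TAb    = res-TAb
        ; ind-TAb    = ind-TAb
        ; con-TAb    = con-TAb
        ; cast-id    = λ {H} e x → Q.≈⇒∼ H refl
        ; cast-trans = λ {_} {_} {L} e e′ e″ x → Q.≈⇒∼ L refl
        ; res-cast   = λ {I} {I′} {H} {H′} → res-cast {I} {I′} {H} {H′}
        ; ind-cast   = λ {_} {_} {_} {H′} e e′ p p′ x → Q.≈⇒∼ H′ refl
        ; con-cast   = λ {_} {g′} {_} {H′} g≈g′ e x →
            Q.≈⇒∼ (conjᴹ g′ H′) (conjBy-cong 𝓖 g≈g′ refl)
        ; res-id     = λ {H} p x → Q.∼-trans H
            (Transfer.transfer-unique (H/R H) (T p) (trivialTransversal ⌊ H ⌋) x (λ _ → x) id
              (λ _ → trans (identityˡ _) (sym (identityʳ _))))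
            (Q.≈⇒∼ H (identityʳ (proj₁ x)))
        ; ind-id     = λ {H} p x → Q.≈⇒∼ H refl
        ; con-id     = con-id
        ; res-trans  = λ {J} {I} {H} p q x → transfer-transitive {N = R I} (H/R J)
            (𝔐⋆-≤ q) (𝔐⋆-≤ p) (T q) (T p) (T (𝔐⋆-trans p q)) (res-TAb p) x
        ; ind-trans  = λ {_} {_} {H} p q x → Q.≈⇒∼ H refl
        ; con-trans  = λ g′ g H (x , _) → Q.≈⇒∼ (conjᴹ (g′ ∙ g) H) (conjBy-action 𝓖 g′ g x)
        ; con-res    = con-res
        ; con-ind    = λ g {_} {H} p x → Q.≈⇒∼ (conjᴹ g H) refl
        ; mackey     = mackey
        }
      ; isCohomological = cohomological
      }

proposition2p4p9 : ∀ {ℓ m : Level} (G : TopologicalGroup ℓ) (𝔐 : MackeySystem G m)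
    (let open MackeySystem 𝔐) →
    (∀ (H : Member) → IsClosed G ⌊ H ⌋) →
    (finiteIndex : ∀ {I H : Member} → I ∈𝔐ᵣ H → FiniteIndex G ⌊ H ⌋ ⌊ I ⌋) →
    (R : AbelianizationSystem G 𝔐) →
    IsCohomologicalMackeyFunctor G 𝔐 (π G 𝔐 finiteIndex R)
proposition2p4p9 G = π-isCohomologicalMackeyFunctor G
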